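{- Let $t\ge 2$ be an integer and let $G$ be a finite simple graph. Then \[ N(G,K_t)\;\le\;\sum_{e\in E(G)}\frac{\binom{p(e)+1}{t}}{\binom{p(e)+1}{2}}\;=\;\frac{1}{\binom{t}{2}}\sum_{e\in E(G)}\binom{p(e)-1}{t-2}. \] If $t=2$, equality always holds. If $t\ge 3$, equality holds if and only if every connected component of $G$ is either a complete graph or contains no path of length $t-1$.
   Context: $N(G,K_t)$ denotes the number of subgraphs of $G$ isomorphic to $K_t$. The length of a path is its number of edges. For an edge $e\in E(G)$, $p(e)$ denotes the length of a longest path in $G$ containing the edge $e$ (so $p(e)\ge 1$). Binomial coefficients $\binom{a}{b}$ with $0\le a<b$ are $0$. -}

module Defs where

open import Data.Bool.Base using (true; false)
open import Data.Fin.Base using (Fin; suc; inject₁)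
import Data.Fin.Properties as Fin
open import Data.Fin.Subset using (Subset; _∈_; Nonempty)
open import Data.Fin.Subset.Properties using (_∈?_)
open import Data.Integer.Base using (+_)
open import Data.List.Base using (List; []; _∷_; allFin; cartesianProduct; cartesianProductWith; filter; foldr; length; map; upTo)
open import Data.List.Extrema.Nat using (max)
open import Data.Nat.Base using (ℕ; zero; suc)
open import Data.Product.Base using (∃; _×_; _,_; uncurry)
open import Data.Rational.Base using (ℚ; 0ℚ; _/_; _+_)
open import Data.Sum.Base using (_⊎_)
open import Data.Vec.Base using (Vec; []; _∷_; lookup)
import Data.Vec.Relation.Unary.AllPairs as AllPairs
open import Data.Vec.Relation.Unary.Linked using (Linked; linked?)
open import Data.Vec.Relation.Unary.Unique.Propositional using (Unique)
open import Function.Bundles using (_⇔_; mk⇔; Equivalence)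
open import Level using (0ℓ)
open import Relation.Binary.Core using (Rel)
open import Relation.Binary.Construct.Closure.ReflexiveTransitive using (Star)
import Relation.Binary.Definitions as B
open import Relation.Binary.PropositionalEquality using (_≡_; _≢_; ≢-sym)
open import Relation.Nullary using (¬_; Dec; ¬?)
open import Relation.Nullary.Decidable using (map′; _×-dec_; _⊎-dec_; _→-dec_)
import Relation.Unary as U

record Graph (n : ℕ) : Set₁ where
  field
    Adj    : Rel (Fin n) 0ℓ
    adj?   : B.Decidable Adj
    sym    : ∀ {u v} → Adj u v → Adj v u
    irrefl : ∀ {v} → ¬ Adj v v

K : (t : ℕ) → Graph t
K t = record
  { Adj    = _≢_
  ; adj?   = λ u v → ¬? (u Fin.≟ v)
  ; sym    = ≢-sym
  ; irrefl = λ v≢v → v≢v _≡_.refl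
  }

-- Each edge {u , v} is listed exactly once, as the pair with u < v.
edges : ∀ {n} → Graph n → List (Fin n × Fin n)
edges {n} G = filter (λ (u , v) → (u Fin.<? v) ×-dec Graph.adj? G u v)
                     (cartesianProduct (allFin n) (allFin n))

allVecs : ∀ {A : Set} → List A → (k : ℕ) → List (Vec A k)
allVecs xs zero    = [] ∷ []
allVecs xs (suc k) = cartesianProductWith _∷_ xs (allVecs xs k)

anyVec? : ∀ {n} k {P : Vec (Fin n) k → Set} → U.Decidable P → Dec (∃ P)
anyVec? zero    P? = map′ ([] ,_) (λ { ([] , p) → p }) (P? [])
anyVec? (suc k) P? =
  map′ (λ (x , xs , p) → x ∷ xs , p) (λ { (x ∷ xs , p) → x , xs , p })
       (Fin.any? λ x → anyVec? k λ xs → P? (x ∷ xs))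

infix 3 _⇔-dec_

_⇔-dec_ : ∀ {A B : Set} → Dec A → Dec B → Dec (A ⇔ B)
a? ⇔-dec b? = map′ (uncurry mk⇔) (λ e → Equivalence.to e , Equivalence.from e)
                   ((a? →-dec b?) ×-dec (b? →-dec a?))

-- A vertex set together with an edge relation given by its adjacency matrix.
-- Two subgraphs are the same iff these data are the same.
record SubgraphData (n : ℕ) : Set where
  constructor _▸_
  field
    verts : Subset n
    rows  : Vec (Subset n) n

  Edge : Rel (Fin n) 0ℓ
  Edge u v = v ∈ lookup rows u

  edge? : B.Decidable Edge
  edge? u v = v ∈? lookup rows u

open SubgraphData

allSubgraphData : ∀ n → List (SubgraphData n)
allSubgraphData n = cartesianProductWith _▸_ subsets (allVecs subsets n)
  where
  subsets : List (Subset n)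
  subsets = allVecs (true ∷ false ∷ []) n

IsSubgraph : ∀ {n} → Graph n → SubgraphData n → Set
IsSubgraph G H = ∀ u v → Edge H u v →
  Edge H v u × u ∈ verts H × v ∈ verts H × Graph.Adj G u v

isSubgraph? : ∀ {n} (G : Graph n) → U.Decidable (IsSubgraph G)
isSubgraph? G H = Fin.all? λ u → Fin.all? λ v → edge? H u v →-dec
  (edge? H v u ×-dec (u ∈? verts H) ×-dec (v ∈? verts H) ×-dec Graph.adj? G u v)

-- f lists the images of the vertices of F under a bijection onto verts H.
IsIso : ∀ {m n} → Graph m → SubgraphData n → Vec (Fin n) m → Set
IsIso F H f =
    (∀ i j → lookup f i ≡ lookup f j → i ≡ j)
  × (∀ v → v ∈ verts H ⇔ ∃ λ i → lookup f i ≡ v)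
  × (∀ i j → Graph.Adj F i j ⇔ Edge H (lookup f i) (lookup f j))

isIso? : ∀ {m n} (F : Graph m) (H : SubgraphData n) → U.Decidable (IsIso F H)
isIso? F H f =
        (Fin.all? λ i → Fin.all? λ j → (lookup f i Fin.≟ lookup f j) →-dec (i Fin.≟ j))
  ×-dec (Fin.all? λ v → (v ∈? verts H) ⇔-dec Fin.any? λ i → lookup f i Fin.≟ v)
  ×-dec (Fin.all? λ i → Fin.all? λ j →
          Graph.adj? F i j ⇔-dec edge? H (lookup f i) (lookup f j))

Isomorphic : ∀ {m n} → Graph m → SubgraphData n → Set
Isomorphic F H = ∃ (IsIso F H)

isomorphic? : ∀ {m n} (F : Graph m) (H : SubgraphData n) → Dec (Isomorphic F H)
isomorphic? {m} F H = anyVec? m (isIso? F H)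

N : ∀ {n m} → Graph n → Graph m → ℕ
N {n} G F = length (filter (λ H → isSubgraph? G H ×-dec isomorphic? F H) (allSubgraphData n))

-- A path of length k is given by its k + 1 vertices in order.
IsPath : ∀ {n k} → Graph n → Vec (Fin n) (suc k) → Set
IsPath G p = Unique p × Linked (Graph.Adj G) p

isPath? : ∀ {n k} (G : Graph n) → U.Decidable (IsPath {n} {k} G)
isPath? G p = AllPairs.allPairs? (λ u v → ¬? (u Fin.≟ v)) p ×-dec linked? (Graph.adj? G) p

Traverses : ∀ {n k} → Fin n × Fin n → Vec (Fin n) (suc k) → Set
Traverses {k = k} (u , v) p = ∃ λ (i : Fin k) →
    (lookup p (inject₁ i) ≡ u × lookup p (suc i) ≡ v)
  ⊎ (lookup p (inject₁ i) ≡ v × lookup p (suc i) ≡ u)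

traverses? : ∀ {n k} (e : Fin n × Fin n) → U.Decidable (Traverses {n} {k} e)
traverses? (u , v) p = Fin.any? λ i →
        ((lookup p (inject₁ i) Fin.≟ u) ×-dec (lookup p (suc i) Fin.≟ v))
  ⊎-dec ((lookup p (inject₁ i) Fin.≟ v) ×-dec (lookup p (suc i) Fin.≟ u))

PathThrough : ∀ {n} → Graph n → Fin n × Fin n → ℕ → Set
PathThrough {n} G e k = ∃ λ (p : Vec (Fin n) (suc k)) → IsPath G p × Traverses e p

pathThrough? : ∀ {n} (G : Graph n) e → U.Decidable (PathThrough G e)
pathThrough? G e k = anyVec? (suc k) λ p → isPath? G p ×-dec traverses? e p

-- A path in a graph on n vertices has length less than n, so it suffices to
-- search the lengths 0, …, n - 1.  The default 0 is attained only at non-edges.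
longest : ∀ {n} → Graph n → Fin n × Fin n → ℕ
longest {n} G e = max 0 (filter (pathThrough? G e) (upTo n))

-- a / b with the convention a / 0 = 0.  The denominators to which it is
-- applied, p(e)+1 choose 2 with p(e) ≥ 1 and t choose 2 with t ≥ 2, are nonzero.
_÷_ : ℕ → ℕ → ℚ
a ÷ zero  = 0ℚ
a ÷ suc b = + a / suc b

infixl 7 _÷_

sumOver : ∀ {A : Set} → List A → (A → ℚ) → ℚ
sumOver xs f = foldr _+_ 0ℚ (map f xs)

IsComponent : ∀ {n} → Graph n → Subset n → Set
IsComponent G C = Nonempty C × (∀ {u} → u ∈ C → ∀ v → v ∈ C ⇔ Star (Graph.Adj G) u v)

-- The subgraph induced on C is complete.
CompleteOn : ∀ {n} → Graph n → Subset n → Set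
CompleteOn G C = ∀ {u v} → u ∈ C → v ∈ C → u ≢ v → Graph.Adj G u v

-- The subgraph induced on C contains a path of length k.
HasPathIn : ∀ {n} → Graph n → Subset n → ℕ → Set
HasPathIn {n} G C k = ∃ λ (p : Vec (Fin n) (suc k)) → IsPath G p × (∀ i → lookup p i ∈ C)

{-# OPTIONS --safe #-}
module Submission where

-- Count ordered cliques: with fall a j = a (a - 1) ... (a - j + 1), the inequality times t! says that
-- the number of ordered t-cliques is at most the sum of fall (p(u,v) - 1) (t - 2) over all ordered
-- edges (u,v).  It is proved for every induced subgraph G[A], with p still computed in G, by
-- induction on |A|.  Let v_0 ... v_k be a longest path of G[A]; all neighbours of its ends lie on it.
--
-- If v_0 ~ v_{i+1} and v_k ~ v_i for some i, the vertices of the path carry a Hamiltonian cycle.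
-- Then no edge of G[A] leaves them, each edge uv among them has p(u,v) >= k, and u and v have at
-- most k - 1 common neighbours, so the inequality holds edge by edge on this set, which is then
-- removed from A.  A non-adjacent pair in it makes some edge strict when k >= t - 1 and t >= 3.
--
-- Otherwise deg v_0 + deg v_k <= k, so one end v has degree d <= k/2 in G[A].  Its edges have
-- p >= k, and removing v destroys at most t * fall d (t - 1) ordered cliques, which is at most
-- 2 d * fall (k - 1) (t - 2) since 2^(t-2) * fall (d - 1) (t - 2) <= fall (k - 1) (t - 2) and
-- t <= 2^(t-1); this is strict when k >= t - 1 and t >= 3.
--
-- Hence equality forces every component with a path of length t - 1 to be complete.  Conversely,
-- if all of these are complete, then each edge uv begins fall (p(u,v) - 1) (t - 2) ordered t-cliques.

open import Defs
open import Data.Bool.Base using (true; false; if_then_else_)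
open import Data.Empty using (⊥; ⊥-elim)
open import Data.Fin.Base as Fin using (Fin; zero; suc; inject₁)
import Data.Fin.Properties as Fin
open import Data.Fin.Subset using (Subset) renaming (_∈_ to _∈ₛ_)
open import Data.Fin.Subset.Properties using (drop-there; ⊆-antisym) renaming (_∈?_ to _∈ₛ?_)
import Data.Integer.Base as ℤ
import Data.Integer.Properties as ℤ
open import Data.List.Base using (List; []; _∷_; [_]; _++_; map; length; filter; reverse; allFin; upTo; cartesianProduct)
open import Data.List.Extrema.Nat using (max; v≤max⁺; argmax-sel)
import Data.List.Membership.DecPropositional as DecMembership
open import Data.List.Membership.Propositional using (_∈_; _∉_; lose)
open import Data.List.Membership.Propositional.Properties
  using (∈-∃++; ∈-++⁻; ∈-++⁺ˡ; ∈-++⁺ʳ; ∈-map⁺; ∈-map⁻; ∈-filter⁺; ∈-filter⁻; ∈-upTo⁺; ∈-allFin; ∈-length;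
         ∈-cartesianProductWith⁺; ∈-AllPairs₂)
open import Data.List.Properties
  using (length-++; length-map; length-tabulate; filter-≐; filter-accept; filter-reject; filter-all; filter-notAll;
         ∷-injectiveʳ; ++-assoc; unfold-reverse)
open import Data.List.Relation.Binary.Permutation.Propositional using (_↭_; ↭-sym; ↭-refl; ↭⇒↭ₛ)
open import Data.List.Relation.Binary.Permutation.Propositional.Properties
  using (map⁺; filter-↭; ∈-resp-↭; ↭-length; ↭-reverse; shift; ++⁺ˡ; ++⁺ʳ; ++-comm)
import Data.List.Relation.Binary.Permutation.Setoid.Properties as Permutationₛ
open import Data.List.Relation.Binary.Sublist.Propositional
  using ([]; _∷_; _∷ʳ_; minimum; ⊆-trans) renaming (_⊆_ to _⊑_; lookup to ⊑-lookup)
open import Data.List.Relation.Binary.Sublist.Propositional.Properties using (filter-⊆; filter⁺)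
open import Data.List.Relation.Binary.Subset.Propositional using (_⊆_)
open import Data.List.Relation.Unary.All as All using (All; []; _∷_)
open import Data.List.Relation.Unary.AllPairs using (AllPairs; []; _∷_)
open import Data.List.Relation.Unary.Any using (here; there)
open import Data.List.Relation.Unary.Unique.Propositional using (Unique)
import Data.List.Relation.Unary.Unique.Propositional.Properties as Unique
open import Data.Nat.Base using (ℕ; zero; suc; _+_; _*_; _∸_; _^_; _≤_; _<_; z≤n; s≤s; _!; NonZero)
open import Data.Nat.Combinatorics using (_C_; nC1≡n; nCk+nC[k+1]≡[n+1]C[k+1]; k>n⇒nCk≡0)
open import Data.Nat.ListAction using (sum)
open import Data.Nat.ListAction.Properties using (sum-↭)
open import Data.Nat.Properties
open import Data.Nat.Tactic.RingSolver using (solve-∀)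
open import Data.Product.Base using (∃; ∃₂; _×_; _,_; proj₁; proj₂)
open import Data.Rational.Base as ℚ using (ℚ; toℚᵘ)
import Data.Rational.Properties as ℚ
open import Data.Rational.Unnormalised.Base as ℚᵘ using (mkℚᵘ; *≡*; *≤*)
import Data.Rational.Unnormalised.Properties as ℚᵘ
open import Data.Sum.Base using (_⊎_; inj₁; inj₂)
open import Data.Vec.Base as Vec using (Vec; []; _∷_; lookup; tabulate; toList; fromList; here; there)
open import Data.Vec.Membership.Propositional.Properties using (∈-lookup; ∈-toList⁺; ∈-toList⁻)
import Data.Vec.Properties as Vec
open import Data.Vec.Relation.Unary.All as VecAll using ([]; _∷_)
open import Data.Vec.Relation.Unary.AllPairs using ([]; _∷_)
import Data.Vec.Relation.Unary.Any as VecAny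
import Data.Vec.Relation.Unary.Any.Properties as VecAny
open import Data.Vec.Relation.Unary.Linked as Linked using ([-]; _∷_)
open import Data.Vec.Relation.Unary.Unique.Propositional using () renaming (Unique to VecUnique)
import Data.Vec.Relation.Unary.Unique.Propositional.Properties as VecUnique
open import Function.Base using (_∘_)
open import Function.Bundles using (_⇔_; mk⇔; Equivalence)
open import Level using (0ℓ)
open import Relation.Binary.Construct.Closure.ReflexiveTransitive as Star using (Star; ε; _◅_; _◅◅_)
open import Relation.Binary.PropositionalEquality hiding ([_])
open import Relation.Nullary using (¬_; Dec; yes; no; does; ¬?)
open import Relation.Nullary.Decidable using (dec-true; decidable-stable; _×-dec_)
open import Relation.Unary using (Pred; Decidable)

-- Falling factorials and binomial coefficients

-- The falling factorial. Truncated subtraction is harmless, since the factor 0 has entered the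
-- product before it takes effect.
fall : ℕ → ℕ → ℕ
fall m zero    = 1
fall m (suc j) = m * fall (m ∸ 1) j

fall-mono : ∀ j {a b} → a ≤ b → fall a j ≤ fall b j
fall-mono zero    a≤b = ≤-refl
fall-mono (suc j) a≤b = *-mono-≤ a≤b (fall-mono j (∸-monoˡ-≤ 1 a≤b))

fall-pos : ∀ j {b} → j ≤ b → 1 ≤ fall b j
fall-pos zero    _         = ≤-refl
fall-pos (suc j) (s≤s j≤b) = ≤-trans (fall-pos j j≤b) (m≤m+n _ _)

fall-zero : ∀ j {b} → b < j → fall b j ≡ 0
fall-zero (suc j) {zero}  _         = refl
fall-zero (suc j) {suc b} (s≤s b<j) = trans (cong (suc b *_) (fall-zero j b<j)) (*-zeroʳ b)

fall-strict : ∀ j {a b} → a < b → suc j ≤ b → fall a (suc j) < fall b (suc j)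
fall-strict j {a} {suc b} (s≤s a≤b) (s≤s j≤b) = begin-strict
  a * fall (a ∸ 1) j  ≤⟨ *-monoʳ-≤ a (fall-mono j (≤-trans (m∸n≤m a 1) a≤b)) ⟩
  a * fall b j        <⟨ m<n+m _ (fall-pos j j≤b) ⟩
  suc a * fall b j    ≤⟨ *-monoˡ-≤ (fall b j) (s≤s a≤b) ⟩
  suc b * fall b j    ∎
  where open ≤-Reasoning

-- Both sides count the subsets of size `suc j` of a set of size `suc m` with one marked element.
-- Pascal's rule reduces the claim to two instances for a smaller set.
C-absorb : ∀ m j → suc j * (suc m C suc j) ≡ suc m * (m C j)
C-absorb zero    zero    = refl
C-absorb zero    (suc j) = begin
  suc (suc j) * (1 C suc (suc j))  ≡⟨ cong (suc (suc j) *_) (k>n⇒nCk≡0 {1} {suc (suc j)} (s≤s (s≤s z≤n))) ⟩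
  suc (suc j) * 0                  ≡⟨ *-zeroʳ (suc (suc j)) ⟩
  0                                ≡⟨ cong (1 *_) (k>n⇒nCk≡0 {0} {suc j} (s≤s z≤n)) ⟨
  1 * (0 C suc j)                  ∎
  where open ≡-Reasoning
C-absorb (suc m) zero    = trans (*-identityˡ _) (trans (nC1≡n (suc (suc m))) (sym (*-identityʳ _)))
C-absorb (suc m) (suc j) = begin
  suc (suc j) * (suc (suc m) C suc (suc j))
    ≡⟨ cong (suc (suc j) *_) (nCk+nC[k+1]≡[n+1]C[k+1] (suc m) (suc j)) ⟨
  suc (suc j) * ((suc m C suc j) + (suc m C suc (suc j)))
    ≡⟨ split j (suc m C suc j) (suc m C suc (suc j)) ⟩
  (suc m C suc j) + (suc j * (suc m C suc j) + suc (suc j) * (suc m C suc (suc j)))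
    ≡⟨ cong ((suc m C suc j) +_) (cong₂ _+_ (C-absorb m j) (C-absorb m (suc j))) ⟩
  (suc m C suc j) + (suc m * (m C j) + suc m * (m C suc j))
    ≡⟨ cong ((suc m C suc j) +_) (*-distribˡ-+ (suc m) (m C j) (m C suc j)) ⟨
  (suc m C suc j) + suc m * ((m C j) + (m C suc j))
    ≡⟨ cong (λ z → (suc m C suc j) + suc m * z) (nCk+nC[k+1]≡[n+1]C[k+1] m j) ⟩
  suc (suc m) * (suc m C suc j) ∎
  where
  open ≡-Reasoning
  split : ∀ j a b → suc (suc j) * (a + b) ≡ a + (suc j * a + suc (suc j) * b)
  split = solve-∀

fall≡!*C : ∀ m j → fall m j ≡ j ! * (m C j)
fall≡!*C m       zero    = refl
fall≡!*C zero    (suc j) = sym (trans (cong ((suc j) ! *_) (k>n⇒nCk≡0 {0} {suc j} (s≤s z≤n))) (*-zeroʳ ((suc j) !)))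
fall≡!*C (suc m) (suc j) = begin
  suc m * fall m j                  ≡⟨ cong (suc m *_) (fall≡!*C m j) ⟩
  suc m * (j ! * (m C j))           ≡⟨ x∙yz≈y∙xz (suc m) (j !) (m C j) ⟩
  j ! * (suc m * (m C j))           ≡⟨ cong (j ! *_) (C-absorb m j) ⟨
  j ! * (suc j * (suc m C suc j))   ≡⟨ *-assoc (j !) (suc j) (suc m C suc j) ⟨
  (j ! * suc j) * (suc m C suc j)   ≡⟨ cong (_* (suc m C suc j)) (*-comm (j !) (suc j)) ⟩
  (suc j) ! * (suc m C suc j)       ∎
  where
  open ≡-Reasoning
  x∙yz≈y∙xz : ∀ x y z → x * (y * z) ≡ y * (x * z)
  x∙yz≈y∙xz = solve-∀

2*C2 : ∀ m → 2 * (suc (suc m) C 2) ≡ suc (suc m) * suc m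
2*C2 m = trans (C-absorb (suc m) 1) (cong (suc (suc m) *_) (nC1≡n (suc m)))

-- Both sides count the pairs of a 2-set inside a set of size `2 + j` inside a set of size `2 + q`,
-- choosing the larger or the smaller set first. This relates the two forms of the summand in the
-- theorem.
C-subset-of-subset : ∀ q j → (suc (suc q) C suc (suc j)) * (suc (suc j) C 2) ≡ (q C j) * (suc (suc q) C 2)
C-subset-of-subset q j = *-cancelˡ-≡ _ _ 2 (begin
  2 * (c * (suc (suc j) C 2))       ≡⟨ r₁ c (suc (suc j) C 2) ⟩
  c * (2 * (suc (suc j) C 2))       ≡⟨ cong (c *_) (2*C2 j) ⟩
  c * (suc (suc j) * suc j)         ≡⟨ r₂ c (suc (suc j)) (suc j) ⟩
  suc j * (suc (suc j) * c)         ≡⟨ cong (suc j *_) (C-absorb (suc q) (suc j)) ⟩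
  suc j * (suc (suc q) * (suc q C suc j)) ≡⟨ r₃ (suc j) (suc (suc q)) (suc q C suc j) ⟩
  suc (suc q) * (suc j * (suc q C suc j)) ≡⟨ cong (suc (suc q) *_) (C-absorb q j) ⟩
  suc (suc q) * (suc q * (q C j))   ≡⟨ r₂′ (suc (suc q)) (suc q) (q C j) ⟩
  (q C j) * (suc (suc q) * suc q)   ≡⟨ cong ((q C j) *_) (2*C2 q) ⟨
  (q C j) * (2 * (suc (suc q) C 2)) ≡⟨ r₁ (q C j) (suc (suc q) C 2) ⟨
  2 * ((q C j) * (suc (suc q) C 2)) ∎)
  where
  open ≡-Reasoning
  c = suc (suc q) C suc (suc j)
  r₁ : ∀ x y → 2 * (x * y) ≡ x * (2 * y)
  r₁ = solve-∀
  r₂ : ∀ x y z → x * (y * z) ≡ z * (y * x)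
  r₂ = solve-∀
  r₃ : ∀ x y z → x * (y * z) ≡ y * (x * z)
  r₃ = solve-∀
  r₂′ : ∀ x y z → x * (y * z) ≡ z * (x * y)
  r₂′ = solve-∀

-- Factor by factor: from `2 * a ≤ b` also twice `a - i` is at most `b - i`.
2^*fall≤fall : ∀ j {a b} → 2 * a ≤ b → 2 ^ j * fall a j ≤ fall b j
2^*fall≤fall zero    _    = ≤-refl
2^*fall≤fall (suc j) {zero}  {b} _ = ≤-trans (≤-reflexive (*-zeroʳ (2 ^ suc j))) z≤n
2^*fall≤fall (suc j) {suc a} {b} 2a≤b = begin
  2 ^ suc j * (suc a * fall a j)     ≡⟨ r (2 ^ j) (suc a) (fall a j) ⟩
  (2 * suc a) * (2 ^ j * fall a j)   ≤⟨ *-mono-≤ 2a≤b (2^*fall≤fall j {a} {b ∸ 1} lem) ⟩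
  b * fall (b ∸ 1) j                 ∎
  where
  open ≤-Reasoning
  r : ∀ x y z → 2 * x * (y * z) ≡ (2 * y) * (x * z)
  r = solve-∀
  lem : 2 * a ≤ b ∸ 1
  lem = ≤-trans (+-monoʳ-≤ a (n≤1+n (a + 0))) (∸-monoˡ-≤ 1 2a≤b)

2+j≤2^1+j : ∀ j → 2 + j ≤ 2 * 2 ^ j
2+j≤2^1+j zero    = ≤-refl
2+j≤2^1+j (suc j) = begin
  3 + j             ≤⟨ +-monoʳ-≤ 3 (m≤m+n j (1 + j)) ⟩
  3 + (j + (1 + j)) ≡⟨ r j ⟩
  2 * (2 + j)       ≤⟨ *-monoʳ-≤ 2 (2+j≤2^1+j j) ⟩
  2 * (2 * 2 ^ j)   ∎
  where
  open ≤-Reasoning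
  r : ∀ j → 3 + (j + (1 + j)) ≡ 2 * (2 + j)
  r = solve-∀

-- With `t = 2 + j`, the left side bounds the ordered cliques through a vertex of degree `d`, and
-- the right side is the least weight of its `d` edges taken in both directions. Doubling each of
-- the `j` last factors gains `2 ^ j`, which together with the outer 2 outweighs `2 + j`.
[2+j]fall≤2fall : ∀ j {d k} → 2 * d ≤ k → (2 + j) * fall d (suc j) ≤ 2 * (d * fall (k ∸ 1) j)
[2+j]fall≤2fall j {d} {k} 2d≤k = begin
  (2 + j) * (d * fall (d ∸ 1) j)         ≤⟨ *-monoˡ-≤ _ (2+j≤2^1+j j) ⟩
  2 * 2 ^ j * (d * fall (d ∸ 1) j)       ≡⟨ r (2 ^ j) d (fall (d ∸ 1) j) ⟩
  2 * (d * (2 ^ j * fall (d ∸ 1) j))     ≤⟨ *-monoʳ-≤ 2 (*-monoʳ-≤ d (2^*fall≤fall j (lem d 2d≤k))) ⟩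
  2 * (d * fall (k ∸ 1) j)               ∎
  where
  open ≤-Reasoning
  r : ∀ x y z → 2 * x * (y * z) ≡ 2 * (y * (x * z))
  r = solve-∀
  lem : ∀ d → 2 * d ≤ k → 2 * (d ∸ 1) ≤ k ∸ 1
  lem zero    _ = z≤n
  lem (suc a) h = ≤-trans (+-monoʳ-≤ a (n≤1+n (a + 0))) (∸-monoˡ-≤ 1 h)

-- From `2 * d ≤ k` follows `2 * (d ∸ 1) < k ∸ 1`, so one factor is more than doubled; the factors
-- after it are positive because `2 + j ≤ k`.
[2+j]fall<2fall : ∀ j {d k} → 1 ≤ d → 2 * d ≤ k → 2 + j ≤ k →
                  (3 + j) * fall d (2 + j) < 2 * (d * fall (k ∸ 1) (suc j))
[2+j]fall<2fall j {suc a} {suc k} 1≤d 2d≤k (s≤s j<k) = begin-strict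
  (3 + j) * (suc a * fall a (suc j))     ≤⟨ *-monoˡ-≤ _ (2+j≤2^1+j (suc j)) ⟩
  2 * 2 ^ suc j * (suc a * fall a (suc j)) ≡⟨ r (2 ^ suc j) (suc a) (fall a (suc j)) ⟩
  2 * (suc a * (2 ^ suc j * fall a (suc j))) <⟨ *-monoʳ-< 2 (*-monoʳ-< (suc a) 2^*fall<fall) ⟩
  2 * (suc a * fall k (suc j))     ∎
  where
  open ≤-Reasoning
  r : ∀ x y z → 2 * x * (y * z) ≡ 2 * (y * (x * z))
  r = solve-∀
  r′ : ∀ x y z → 2 * x * (y * z) ≡ (2 * y) * (x * z)
  r′ = solve-∀
  2a<k : 2 * a < k
  2a<k = ≤-pred (≤-trans (≤-reflexive (cong suc (sym (+-suc a (a + 0))))) 2d≤k)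
  lem : ∀ a {k} → 2 * a < k → 2 * (a ∸ 1) ≤ k ∸ 1
  lem zero    _ = z≤n
  lem (suc a) h = ≤-trans (+-monoʳ-≤ a (n≤1+n (a + 0))) (∸-monoˡ-≤ 1 (<⇒≤ h))
  2^*fall<fall : 2 ^ suc j * fall a (suc j) < fall k (suc j)
  2^*fall<fall = begin-strict
    2 ^ suc j * (a * fall (a ∸ 1) j)       ≡⟨ r′ (2 ^ j) a (fall (a ∸ 1) j) ⟩
    (2 * a) * (2 ^ j * fall (a ∸ 1) j)     ≤⟨ *-monoʳ-≤ (2 * a) (2^*fall≤fall j (lem a 2a<k)) ⟩
    (2 * a) * fall (k ∸ 1) j               <⟨ m<n+m _ (fall-pos j (∸-monoˡ-≤ 1 j<k)) ⟩
    suc (2 * a) * fall (k ∸ 1) j           ≤⟨ *-monoˡ-≤ (fall (k ∸ 1) j) 2a<k ⟩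
    k * fall (k ∸ 1) j                     ∎

-- Sums over lists

variable
  A : Set
  B : Set
  P : Pred A 0ℓ
  Q : Pred A 0ℓ

sumBy : List A → (A → ℕ) → ℕ
sumBy xs f = sum (map f xs)

sumBy-cong : ∀ (xs : List A) {f g : A → ℕ} → (∀ {x} → x ∈ xs → f x ≡ g x) → sumBy xs f ≡ sumBy xs g
sumBy-cong []       f≡g = refl
sumBy-cong (x ∷ xs) f≡g = cong₂ _+_ (f≡g (here refl)) (sumBy-cong xs (f≡g ∘ there))

sumBy-mono : ∀ (xs : List A) {f g : A → ℕ} → (∀ {x} → x ∈ xs → f x ≤ g x) → sumBy xs f ≤ sumBy xs g
sumBy-mono []       f≤g = z≤n
sumBy-mono (x ∷ xs) f≤g = +-mono-≤ (f≤g (here refl)) (sumBy-mono xs (f≤g ∘ there))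

+-tight : ∀ {a b c d} → a ≤ c → b ≤ d → a + b ≡ c + d → a ≡ c × b ≡ d
+-tight {a} {b} {c} {d} a≤c b≤d eq = a≡c , +-cancelˡ-≡ a b d (trans eq (cong (_+ d) (sym a≡c)))
  where
  a≡c : a ≡ c
  a≡c = ≤-antisym a≤c (+-cancelʳ-≤ b c a (≤-trans (+-monoʳ-≤ c b≤d) (≤-reflexive (sym eq))))

sumBy-tight : ∀ (xs : List A) {f g : A → ℕ} → (∀ {x} → x ∈ xs → f x ≤ g x) →
              sumBy xs f ≡ sumBy xs g → ∀ {x} → x ∈ xs → f x ≡ g x
sumBy-tight (x ∷ xs) f≤g eq x∈ with +-tight (f≤g (here refl)) (sumBy-mono xs (f≤g ∘ there)) eq | x∈
... | fx≡gx , _  | here refl = fx≡gx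
... | _     , eq′ | there y∈ = sumBy-tight xs (f≤g ∘ there) eq′ y∈

sumBy-+ : ∀ (xs : List A) (f g : A → ℕ) → sumBy xs (λ x → f x + g x) ≡ sumBy xs f + sumBy xs g
sumBy-+ []       f g = refl
sumBy-+ (x ∷ xs) f g = trans (cong (f x + g x +_) (sumBy-+ xs f g)) (r (f x) (g x) (sumBy xs f) (sumBy xs g))
  where
  r : ∀ a b c d → a + b + (c + d) ≡ a + c + (b + d)
  r = solve-∀

sumBy-*ˡ : ∀ (xs : List A) c (f : A → ℕ) → sumBy xs (λ x → c * f x) ≡ c * sumBy xs f
sumBy-*ˡ []       c f = sym (*-zeroʳ c)
sumBy-*ˡ (x ∷ xs) c f = trans (cong (c * f x +_) (sumBy-*ˡ xs c f)) (sym (*-distribˡ-+ c (f x) (sumBy xs f)))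

sumBy-const : ∀ (xs : List A) c → sumBy xs (λ _ → c) ≡ length xs * c
sumBy-const []       c = refl
sumBy-const (x ∷ xs) c = cong (c +_) (sumBy-const xs c)

sumBy-≤const : ∀ (xs : List A) {f : A → ℕ} c → (∀ {x} → x ∈ xs → f x ≤ c) → sumBy xs f ≤ length xs * c
sumBy-≤const xs c f≤c = ≤-trans (sumBy-mono xs f≤c) (≤-reflexive (sumBy-const xs c))

sumBy-≥const : ∀ (xs : List A) {f : A → ℕ} c → (∀ {x} → x ∈ xs → c ≤ f x) → length xs * c ≤ sumBy xs f
sumBy-≥const xs c c≤f = ≤-trans (≤-reflexive (sym (sumBy-const xs c))) (sumBy-mono xs c≤f)

sumBy-↭ : ∀ {xs ys : List A} (f : A → ℕ) → xs ↭ ys → sumBy xs f ≡ sumBy ys f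
sumBy-↭ f p = sum-↭ (map⁺ f p)

sumBy-partition : ∀ (P? : Decidable P) (xs : List A) (f : A → ℕ) →
  sumBy xs f ≡ sumBy (filter P? xs) f + sumBy (filter (¬? ∘ P?) xs) f
sumBy-partition P? []       f = refl
sumBy-partition P? (x ∷ xs) f with P? x
... | yes _ = trans (cong (f x +_) (sumBy-partition P? xs f)) (sym (+-assoc (f x) _ _))
... | no  _ = trans (cong (f x +_) (sumBy-partition P? xs f))
                    (r (f x) (sumBy (filter P? xs) f) (sumBy (filter (¬? ∘ P?) xs) f))
  where
  r : ∀ a b c → a + (b + c) ≡ b + (a + c)
  r = solve-∀

sumBy-filter : ∀ (P? : Decidable P) (xs : List A) (f : A → ℕ) →
  sumBy (filter P? xs) f ≡ sumBy xs (λ x → if does (P? x) then f x else 0)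
sumBy-filter P? []       f = refl
sumBy-filter P? (x ∷ xs) f with P? x
... | yes _ = cong (f x +_) (sumBy-filter P? xs f)
... | no  _ = sumBy-filter P? xs f

sumBy-++ : ∀ (xs ys : List A) (f : A → ℕ) → sumBy (xs ++ ys) f ≡ sumBy xs f + sumBy ys f
sumBy-++ []       ys f = refl
sumBy-++ (x ∷ xs) ys f = trans (cong (f x +_) (sumBy-++ xs ys f)) (sym (+-assoc (f x) _ _))

sumBy-swap : ∀ (xs : List A) (ys : List B) (f : A → B → ℕ) →
  sumBy xs (λ x → sumBy ys (f x)) ≡ sumBy ys (λ y → sumBy xs (λ x → f x y))
sumBy-swap []       ys f = sym (trans (sumBy-const ys 0) (*-zeroʳ (length ys)))
sumBy-swap (x ∷ xs) ys f = trans (cong (sumBy ys (f x) +_) (sumBy-swap xs ys f))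
                                   (sym (sumBy-+ ys (f x) (λ y → sumBy xs (λ x → f x y))))

filter-cong : ∀ (P? : Decidable P) (Q? : Decidable Q) (xs : List A) →
  (∀ {x} → x ∈ xs → P x → Q x) → (∀ {x} → x ∈ xs → Q x → P x) → filter P? xs ≡ filter Q? xs
filter-cong P? Q? []       P⇒Q Q⇒P = refl
filter-cong P? Q? (x ∷ xs) P⇒Q Q⇒P with P? x | Q? x
... | yes _ | yes _ = cong (x ∷_) (filter-cong P? Q? xs (P⇒Q ∘ there) (Q⇒P ∘ there))
... | no  _ | no  _ = filter-cong P? Q? xs (P⇒Q ∘ there) (Q⇒P ∘ there)
... | yes p | no ¬q = ⊥-elim (¬q (P⇒Q (here refl) p))
... | no ¬p | yes q = ⊥-elim (¬p (Q⇒P (here refl) q))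

filter-comm : ∀ (P? : Decidable P) (Q? : Decidable Q) (xs : List A) →
  filter P? (filter Q? xs) ≡ filter Q? (filter P? xs)
filter-comm P? Q? []       = refl
filter-comm P? Q? (x ∷ xs) with Q? x in q | P? x in p
... | yes _ | yes _ rewrite p | q = cong (x ∷_) (filter-comm P? Q? xs)
... | yes _ | no  _ rewrite p     = filter-comm P? Q? xs
... | no  _ | yes _ rewrite q     = filter-comm P? Q? xs
... | no  _ | no  _               = filter-comm P? Q? xs

-- The occurrence of the head is cut out of `ys`, and uniqueness keeps the tail inside what remains.
-- All size estimates below rest on this.
Unique-⊆⇒length≤ : ∀ {xs ys : List A} → Unique xs → xs ⊆ ys → length xs ≤ length ys
Unique-⊆⇒length≤ {xs = []}     _          _     = z≤n
Unique-⊆⇒length≤ {xs = x ∷ xs} u@(_ ∷ u′) xs⊆ys with ∈-∃++ (xs⊆ys (here refl))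
... | as , bs , refl = begin
  suc (length xs)                ≤⟨ s≤s (Unique-⊆⇒length≤ u′ xs⊆) ⟩
  suc (length (as ++ bs))        ≡⟨ cong suc (length-++ as) ⟩
  suc (length as + length bs)    ≡⟨ +-suc (length as) (length bs) ⟨
  length as + length (x ∷ bs)    ≡⟨ length-++ as ⟨
  length (as ++ x ∷ bs)          ∎
  where
  open ≤-Reasoning
  xs⊆ : xs ⊆ as ++ bs
  xs⊆ {y} y∈ with ∈-++⁻ as (xs⊆ys (there y∈))
  ... | inj₁ y∈as          = ∈-++⁺ˡ y∈as
  ... | inj₂ (here refl)   = ⊥-elim (Unique.Unique[x∷xs]⇒x∉xs u y∈)
  ... | inj₂ (there y∈bs)  = ∈-++⁺ʳ as y∈bs

Unique-resp-↭ : ∀ {A : Set} {xs ys : List A} → xs ↭ ys → Unique xs → Unique ys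
Unique-resp-↭ p = Permutationₛ.Unique-resp-↭ (setoid _) (↭⇒↭ₛ p)

-- Transfer of distinctness between vectors and lists

toList-All⁻ : ∀ {A : Set} {P : A → Set} {m} (xs : Vec A m) → All P (toList xs) → VecAll.All P xs
toList-All⁻ []       []       = []
toList-All⁻ (x ∷ xs) (p ∷ ps) = p ∷ toList-All⁻ xs ps

toList-All⁺ : ∀ {A : Set} {P : A → Set} {m} {xs : Vec A m} → VecAll.All P xs → All P (toList xs)
toList-All⁺ []       = []
toList-All⁺ (p ∷ ps) = p ∷ toList-All⁺ ps

toList-Unique⁻ : ∀ {A : Set} {m} (xs : Vec A m) → Unique (toList xs) → VecUnique xs
toList-Unique⁻ []       []       = []
toList-Unique⁻ (x ∷ xs) (p ∷ ps) = toList-All⁻ xs p ∷ toList-Unique⁻ xs ps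

toList-Unique⁺ : ∀ {A : Set} {m} {xs : Vec A m} → VecUnique xs → Unique (toList xs)
toList-Unique⁺ []       = []
toList-Unique⁺ (p ∷ ps) = toList-All⁺ p ∷ toList-Unique⁺ ps

-- Ordered cliques, walks and the longest path through an edge

module Tuples {n : ℕ} (G : Graph n) where

  open Graph G renaming (sym to Adj-sym; irrefl to Adj-irrefl)

  V : List (Fin n)
  V = allFin n

  nb : Fin n → List (Fin n) → List (Fin n)
  nb x = filter (adj? x)

  -- The number of ordered t-tuples of pairwise adjacent vertices from xs.
  tuples : ℕ → List (Fin n) → ℕ
  tuples zero    xs = 1
  tuples (suc t) xs = sumBy xs (λ x → tuples t (nb x xs))

  -- Splitting by whether the first vertex is used lists each clique of a duplicate-free `xs` once,
  -- in the order of `xs`, whereas `tuples` counts all its orderings.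
  cliques : ℕ → List (Fin n) → List (List (Fin n))
  cliques zero    xs       = [ [] ]
  cliques (suc t) []       = []
  cliques (suc t) (x ∷ xs) = map (x ∷_) (cliques t (nb x xs)) ++ cliques (suc t) xs

  -- Each edge inside `xs` is counted in both directions.
  edgeSum : (Fin n → Fin n → ℕ) → List (Fin n) → ℕ
  edgeSum w xs = sumBy xs (λ u → sumBy (nb u xs) (w u))

  nb-self : ∀ x xs → nb x (x ∷ xs) ≡ nb x xs
  nb-self x xs = filter-reject (adj? x) Adj-irrefl

  tuples-↭ : ∀ t {xs ys} → xs ↭ ys → tuples t xs ≡ tuples t ys
  tuples-↭ zero    p = refl
  tuples-↭ (suc t) {xs} {ys} p = trans (sumBy-↭ _ p)
    (sumBy-cong ys (λ {x} _ → tuples-↭ t (filter-↭ (adj? x) p)))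

  edgeSum-↭ : ∀ w {xs ys} → xs ↭ ys → edgeSum w xs ≡ edgeSum w ys
  edgeSum-↭ w {xs} {ys} p = trans (sumBy-↭ _ p)
    (sumBy-cong ys (λ {x} _ → sumBy-↭ (w x) (filter-↭ (adj? x) p)))

  -- The vertex x can stand in any of the suc t positions of a tuple.
  tuples-cons : ∀ t x xs → tuples (suc t) (x ∷ xs) ≡ tuples (suc t) xs + suc t * tuples t (nb x xs)
  tuples-cons zero    x xs = +-comm 1 (tuples 1 xs)
  tuples-cons (suc t) x xs = begin
    tuples (suc t) (nb x (x ∷ xs)) + sumBy xs (λ y → tuples (suc t) (nb y (x ∷ xs)))
      ≡⟨ cong₂ _+_ (cong (tuples (suc t)) (nb-self x xs)) (sumBy-cong xs (λ {y} _ → at y)) ⟩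
    k + sumBy xs (λ y → tuples (suc t) (nb y xs) + suc t * g y)
      ≡⟨ cong (k +_) (trans (sumBy-+ xs _ _) (cong (tuples (2 + t) xs +_) (sumBy-*ˡ xs (suc t) g))) ⟩
    k + (tuples (2 + t) xs + suc t * sumBy xs g)
      ≡⟨ cong (λ z → k + (tuples (2 + t) xs + suc t * z)) (sumBy-filter (adj? x) xs _) ⟨
    k + (tuples (2 + t) xs + suc t * k)
      ≡⟨ r k (tuples (2 + t) xs) t ⟩
    tuples (2 + t) xs + suc (suc t) * k ∎
    where
    open ≡-Reasoning
    k = tuples (suc t) (nb x xs)
    g : Fin n → ℕ
    g y = if does (adj? x y) then tuples t (nb y (nb x xs)) else 0
    r : ∀ k a t → k + (a + suc t * k) ≡ a + suc (suc t) * k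
    r = solve-∀
    -- Only the neighbours `y` of `x` see the new vertex; for these the induction on `t` places `x`
    -- in one of the later positions.
    at : ∀ y → tuples (suc t) (nb y (x ∷ xs)) ≡ tuples (suc t) (nb y xs) + suc t * g y
    at y with adj? x y
    ... | yes x~y = begin
      tuples (suc t) (nb y (x ∷ xs))
        ≡⟨ cong (tuples (suc t)) (filter-accept (adj? y) (Adj-sym x~y)) ⟩
      tuples (suc t) (x ∷ nb y xs)
        ≡⟨ tuples-cons t x (nb y xs) ⟩
      tuples (suc t) (nb y xs) + suc t * tuples t (nb x (nb y xs))
        ≡⟨ cong (λ zs → tuples (suc t) (nb y xs) + suc t * tuples t zs) (filter-comm (adj? x) (adj? y) xs) ⟩
      tuples (suc t) (nb y xs) + suc t * tuples t (nb y (nb x xs)) ∎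
    ... | no ¬x~y = begin
      tuples (suc t) (nb y (x ∷ xs))
        ≡⟨ cong (tuples (suc t)) (filter-reject (adj? y) (¬x~y ∘ Adj-sym)) ⟩
      tuples (suc t) (nb y xs)
        ≡⟨ +-identityʳ _ ⟨
      tuples (suc t) (nb y xs) + 0
        ≡⟨ cong (tuples (suc t) (nb y xs) +_) (*-zeroʳ (suc t)) ⟨
      tuples (suc t) (nb y xs) + suc t * 0 ∎

  -- Removing the first vertex gives both counts the same recursion; the factors `suc t` from
  -- `tuples-cons` build up the factorial.
  tuples≡!*cliques : ∀ t xs → tuples t xs ≡ t ! * length (cliques t xs)
  tuples≡!*cliques zero    xs       = refl
  tuples≡!*cliques (suc t) []       = sym (*-zeroʳ ((suc t) !))
  tuples≡!*cliques (suc t) (x ∷ xs) = begin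
    tuples (suc t) (x ∷ xs)
      ≡⟨ tuples-cons t x xs ⟩
    tuples (suc t) xs + suc t * tuples t (nb x xs)
      ≡⟨ cong₂ _+_ (tuples≡!*cliques (suc t) xs) (cong (suc t *_) (tuples≡!*cliques t (nb x xs))) ⟩
    suc t * t ! * b + suc t * (t ! * a)
      ≡⟨ r (suc t) (t !) a b ⟩
    suc t * t ! * (a + b)
      ≡⟨ cong ((suc t) ! *_) (sym len) ⟩
    (suc t) ! * length (cliques (suc t) (x ∷ xs)) ∎
    where
    open ≡-Reasoning
    a = length (cliques t (nb x xs))
    b = length (cliques (suc t) xs)
    len : length (cliques (suc t) (x ∷ xs)) ≡ a + b
    len = trans (length-++ (map (x ∷_) (cliques t (nb x xs)))) (cong (_+ b) (length-map (x ∷_) (cliques t (nb x xs))))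
    r : ∀ s f a b → s * f * b + s * (f * a) ≡ s * f * (a + b)
    r = solve-∀

  nb-Unique : ∀ x {xs} → Unique xs → Unique (nb x xs)
  nb-Unique x = Unique.filter⁺ (adj? x)

  nb-Unique-∷ : ∀ x {xs} → Unique xs → Unique (x ∷ nb x xs)
  nb-Unique-∷ x {xs} u =
    All.tabulate (λ y∈ → λ { refl → Adj-irrefl (proj₂ (∈-filter⁻ (adj? x) {xs = xs} y∈)) }) ∷ nb-Unique x u

  nb-⊆ : ∀ x {xs} → nb x xs ⊆ xs
  nb-⊆ x {xs} y∈ = proj₁ (∈-filter⁻ (adj? x) {xs = xs} y∈)

  ∈-nb⁻ : ∀ x {xs y} → y ∈ nb x xs → Adj x y
  ∈-nb⁻ x {xs} y∈ = proj₂ (∈-filter⁻ (adj? x) {xs = xs} y∈)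

  nb-length : ∀ {x xs} → Unique xs → x ∈ xs → length (nb x xs) ≤ length xs ∸ 1
  nb-length {x} {xs} u x∈ = ∸-monoˡ-≤ 1 (Unique-⊆⇒length≤ (nb-Unique-∷ x u) λ { (here refl) → x∈ ; (there y∈) → nb-⊆ x y∈ })

  -- Once the first vertex is chosen, the others come from its neighbours, of which there are at
  -- most `length xs ∸ 1`.
  tuples≤fall : ∀ t {xs} → Unique xs → tuples t xs ≤ fall (length xs) t
  tuples≤fall zero    u = ≤-refl
  tuples≤fall (suc t) {xs} u = sumBy-≤const xs _ (λ {x} x∈ →
    ≤-trans (tuples≤fall t (nb-Unique x u)) (fall-mono t (nb-length u x∈)))

  fall≤tuples : ∀ t {xs} → Unique xs → (∀ {x y} → x ∈ xs → y ∈ xs → x ≢ y → Adj x y) →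
                fall (length xs) t ≤ tuples t xs
  fall≤tuples zero    u adj = ≤-refl
  fall≤tuples (suc t) {xs} u adj = sumBy-≥const xs _ (λ {x} x∈ →
    ≤-trans (fall-mono t (∸-monoˡ-≤ 1 (Unique-⊆⇒length≤ u (cover x x∈))))
            (fall≤tuples t (nb-Unique x u) (λ y∈ z∈ → adj (nb-⊆ x y∈) (nb-⊆ x z∈))))
    where
    cover : ∀ x → x ∈ xs → xs ⊆ x ∷ nb x xs
    cover x x∈ {y} y∈ with y Fin.≟ x
    ... | yes refl = here refl
    ... | no  y≢x  = there (∈-filter⁺ (adj? x) y∈ (adj x∈ y∈ (y≢x ∘ sym)))

  edgeSum-cons : ∀ w x xs →
    edgeSum w (x ∷ xs) ≡ edgeSum w xs + (sumBy (nb x xs) (w x) + sumBy (nb x xs) (λ y → w y x))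
  edgeSum-cons w x xs = begin
    sumBy (nb x (x ∷ xs)) (w x) + sumBy xs (λ y → sumBy (nb y (x ∷ xs)) (w y))
      ≡⟨ cong₂ _+_ (cong (λ zs → sumBy zs (w x)) (nb-self x xs)) (sumBy-cong xs (λ {y} _ → at y)) ⟩
    a + sumBy xs (λ y → sumBy (nb y xs) (w y) + g y)
      ≡⟨ cong (a +_) (sumBy-+ xs _ g) ⟩
    a + (edgeSum w xs + sumBy xs g)
      ≡⟨ cong (λ z → a + (edgeSum w xs + z)) (sumBy-filter (adj? x) xs _) ⟨
    a + (edgeSum w xs + sumBy (nb x xs) (λ y → w y x))
      ≡⟨ r a (edgeSum w xs) _ ⟩
    edgeSum w xs + (a + sumBy (nb x xs) (λ y → w y x)) ∎
    where
    open ≡-Reasoning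
    a = sumBy (nb x xs) (w x)
    g : Fin n → ℕ
    g y = if does (adj? x y) then w y x else 0
    r : ∀ a b c → a + (b + c) ≡ b + (a + c)
    r = solve-∀
    at : ∀ y → sumBy (nb y (x ∷ xs)) (w y) ≡ sumBy (nb y xs) (w y) + g y
    at y with adj? x y
    ... | yes x~y = trans (cong (λ zs → sumBy zs (w y)) (filter-accept (adj? y) (Adj-sym x~y))) (+-comm (w y x) _)
    ... | no ¬x~y = trans (cong (λ zs → sumBy zs (w y)) (filter-reject (adj? y) (¬x~y ∘ Adj-sym))) (sym (+-identityʳ _))

  -- Indexed by both ends and by the vertex list, so that cutting, joining and reversing follow the
  -- list operations. Distinctness of the vertices is stated separately.
  data Walk : Fin n → Fin n → List (Fin n) → Set where
    stop : ∀ {a} → Walk a a [ a ]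
    step : ∀ {a b c xs} → Adj a b → Walk b c xs → Walk a c (a ∷ xs)

  Walk-join : ∀ {a b c d xs ys} → Walk a b xs → Adj b c → Walk c d ys → Walk a d (xs ++ ys)
  Walk-join stop        b~c w′ = step b~c w′
  Walk-join (step e w)  b~c w′ = step e (Walk-join w b~c w′)

  Walk-reverse : ∀ {a b xs} → Walk a b xs → Walk b a (reverse xs)
  Walk-reverse stop = stop
  Walk-reverse (step {a} {xs = xs} e w) =
    subst (Walk _ a) (sym (unfold-reverse a xs)) (Walk-join (Walk-reverse w) (Adj-sym e) stop)

  Walk-head : ∀ {a b x xs} → Walk a b (x ∷ xs) → x ≡ a
  Walk-head stop       = refl
  Walk-head (step _ _) = refl

  Walk-start∈ : ∀ {a b xs} → Walk a b xs → a ∈ xs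
  Walk-start∈ stop       = here refl
  Walk-start∈ (step _ _) = here refl

  Walk-end∈ : ∀ {a b xs} → Walk a b xs → b ∈ xs
  Walk-end∈ stop       = here refl
  Walk-end∈ (step _ w) = there (Walk-end∈ w)

  Walk-split : ∀ {a b v} xs {ys} → Walk a b (xs ++ v ∷ ys) →
    Walk v b (v ∷ ys) × ((xs ≡ [] × a ≡ v) ⊎ ∃ λ d → Walk a d xs × Adj d v)
  Walk-split []       w with Walk-head w
  ... | refl = w , inj₁ (refl , refl)
  Walk-split (x ∷ []) (step e w) with Walk-head w
  ... | refl = w , inj₂ (x , stop , e)
  Walk-split (x ∷ xs@(_ ∷ _)) (step e w) with Walk-split xs w
  ... | w′ , inj₂ (d , w″ , e′) = w′ , inj₂ (d , step e w″ , e′)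

  Walk⇒Linked : ∀ {a b m} (q : Vec (Fin n) m) → Walk a b (toList q) → Linked.Linked Adj q
  Walk⇒Linked (_ ∷ [])    stop = [-]
  Walk⇒Linked (_ ∷ y ∷ q) (step e w) with Walk-head w
  ... | refl = e ∷ Walk⇒Linked (y ∷ q) w

  Linked⇒Walk : ∀ {m} (q : Vec (Fin n) (suc m)) → Linked.Linked Adj q → ∃ λ b → Walk (Vec.head q) b (toList q)
  Linked⇒Walk (x ∷ [])    [-]     = x , stop
  Linked⇒Walk (x ∷ y ∷ q) (e ∷ l) with Linked⇒Walk (y ∷ q) l
  ... | b , w = b , step e w

  traverses-consecutive : ∀ {m} (q : Vec (Fin n) (suc m)) {u v} xs {ys} →
    toList q ≡ xs ++ u ∷ v ∷ ys → Traverses (u , v) q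
  traverses-consecutive (_ ∷ _ ∷ _) [] refl = zero , inj₁ (refl , refl)
  traverses-consecutive (_ ∷ [])    (_ ∷ []) ()
  traverses-consecutive (_ ∷ [])    (_ ∷ _ ∷ _) ()
  traverses-consecutive (_ ∷ q@(_ ∷ _)) (x ∷ xs) eq with traverses-consecutive q xs (∷-injectiveʳ eq)
  ... | i , t = suc i , t

  -- Bounds on the longest path through an edge

  Unique⇒length≤n : ∀ {xs : List (Fin n)} → Unique xs → length xs ≤ n
  Unique⇒length≤n u = ≤-trans (Unique-⊆⇒length≤ u (λ {x} _ → ∈-allFin x)) (≤-reflexive (length-tabulate (λ i → i)))

  p : Fin n → Fin n → ℕ
  p u v = longest G (u , v)

  consecutive⇒≤p : ∀ {a b u v} xs {ys} → Walk a b (xs ++ u ∷ v ∷ ys) → Unique (xs ++ u ∷ v ∷ ys) →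
                 length (xs ++ u ∷ v ∷ ys) ≤ suc (p u v)
  consecutive⇒≤p {a} {b} {u} {v} xs {ys} w uniq = go (xs ++ u ∷ v ∷ ys) refl w uniq
    where
    -- The list is made a variable so that matching exposes its first entry: a path of length `k` is
    -- a vector of `suc k` vertices.
    go : ∀ zs → zs ≡ xs ++ u ∷ v ∷ ys → Walk a b zs → Unique zs → length zs ≤ suc (p u v)
    go (z ∷ zs) eq w uniq = s≤s (v≤max⁺ 0 (filter (pathThrough? G (u , v)) (upTo n)) (inj₂ (lose k∈ ≤-refl)))
      where
      q = fromList (z ∷ zs)
      toList-q : toList q ≡ z ∷ zs
      toList-q = Vec.toList∘fromList (z ∷ zs)
      through : PathThrough G (u , v) (length zs)
      through = q , (toList-Unique⁻ q (subst Unique (sym toList-q) uniq)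
                    , Walk⇒Linked q (subst (Walk a b) (sym toList-q) w))
                  , traverses-consecutive q xs (trans toList-q eq)
      -- `longest` searches only lengths below `n`, and a duplicate-free list of `suc (length zs)`
      -- vertices stays within that range.
      k∈ : length zs ∈ filter (pathThrough? G (u , v)) (upTo n)
      k∈ = ∈-filter⁺ (pathThrough? G (u , v)) (∈-upTo⁺ (Unique⇒length≤n uniq)) through

  Traverses-swap : ∀ {u v m} {q : Vec (Fin n) (suc m)} → Traverses (u , v) q → Traverses (v , u) q
  Traverses-swap (i , inj₁ e) = i , inj₂ e
  Traverses-swap (i , inj₂ e) = i , inj₁ e

  p-sym : ∀ u v → p u v ≡ p v u
  p-sym u v = cong (max 0) (filter-≐ (pathThrough? G (u , v)) (pathThrough? G (v , u))
    ((λ (q , path , tr) → q , path , Traverses-swap {q = q} tr) ,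
     (λ (q , path , tr) → q , path , Traverses-swap {q = q} tr)) (upTo n))

  p-attained : ∀ u v → 1 ≤ p u v → PathThrough G (u , v) (p u v)
  p-attained u v 1≤p with argmax-sel (λ k → k) 0 (filter (pathThrough? G (u , v)) (upTo n))
  -- The default value 0 of the maximum is excluded by `1 ≤ p u v`.
  ... | inj₁ p≡0 = ⊥-elim (<⇒≢ 1≤p (sym p≡0))
  ... | inj₂ p∈  = proj₂ (∈-filter⁻ (pathThrough? G (u , v)) {xs = upTo n} p∈)

  Adj⇒≢ : ∀ {u v} → Adj u v → u ≢ v
  Adj⇒≢ u~v refl = Adj-irrefl u~v

  1≤p : ∀ {u v} → Adj u v → 1 ≤ p u v
  1≤p u~v = ≤-pred (consecutive⇒≤p [] (step u~v stop) ((Adj⇒≢ u~v ∷ []) ∷ ([] ∷ [])))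

  -- Reversing the part of the path before v turns u~v into a step of the path.
  start-neighbour⇒≤p : ∀ {u b v xs} → Walk u b xs → Unique xs → v ∈ xs → Adj u v → length xs ≤ suc (p u v)
  start-neighbour⇒≤p {u} {b} {v} w uniq v∈ u~v with ∈-∃++ v∈
  ... | ys , zs , refl with Walk-split ys w
  ... | _  , inj₁ (_ , refl) = ⊥-elim (Adj-irrefl u~v)
  ... | w₂ , inj₂ (d , w₁ , _) with ys | w₁
  ... | y ∷ ys′ | w₁ with Walk-head w₁
  ... | refl = begin
    length (u ∷ ys′ ++ v ∷ zs)           ≡⟨ ↭-length perm ⟩
    length (reverse ys′ ++ u ∷ v ∷ zs)   ≤⟨ consecutive⇒≤p (reverse ys′) walk (Unique-resp-↭ perm uniq) ⟩
    suc (p u v)                          ∎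
    where
    open ≤-Reasoning
    rearrange : reverse (u ∷ ys′) ++ v ∷ zs ≡ reverse ys′ ++ u ∷ v ∷ zs
    rearrange = trans (cong (_++ v ∷ zs) (unfold-reverse u ys′)) (++-assoc (reverse ys′) [ u ] (v ∷ zs))
    perm : (u ∷ ys′) ++ v ∷ zs ↭ reverse ys′ ++ u ∷ v ∷ zs
    perm = subst ((u ∷ ys′) ++ v ∷ zs ↭_) rearrange (++⁺ʳ (v ∷ zs) (↭-sym (↭-reverse (u ∷ ys′))))
    walk : Walk d b (reverse ys′ ++ u ∷ v ∷ zs)
    walk = subst (Walk d b) rearrange (Walk-join (Walk-reverse w₁) u~v w₂)

-- The inequality and its tightness on an induced subgraph

-- A bound that is attained is the maximum, and one that is not attained can be lowered. For a
-- general `P` this case split is available only under a double negation.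
¬¬-maximum : ∀ {P : ℕ → Set} b → (∀ m → P m → m ≤ b) → ∀ {m} → P m →
             ¬ ¬ (∃ λ k → P k × ∀ m → P m → m ≤ k)
¬¬-maximum zero    bound pm none = none (_ , pm , λ m′ p′ → ≤-trans (bound m′ p′) z≤n)
¬¬-maximum {P} (suc b) bound pm none = ¬¬-maximum b smaller pm none
  where
  smaller : ∀ m → P m → m ≤ b
  smaller m pm with m≤n⇒m<n∨m≡n (bound m pm)
  ... | inj₁ (s≤s m≤b) = m≤b
  ... | inj₂ refl      = ⊥-elim (none (suc b , pm , bound))

module Extremal {n : ℕ} (G : Graph n) where

  open Graph G renaming (sym to Adj-sym; irrefl to Adj-irrefl)
  open Tuples G
  open DecMembership (Fin._≟_ {n}) using (_∈?_)

  record PathIn (A : List (Fin n)) (a b : Fin n) (xs : List (Fin n)) : Set where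
    constructor path
    field
      walk   : Walk a b xs
      unique : Unique xs
      within : xs ⊆ A

  open PathIn using (unique)

  PathIn-reverse : ∀ {A a b xs} → PathIn A a b xs → PathIn A b a (reverse xs)
  PathIn-reverse {xs = xs} (path w u i) =
    path (Walk-reverse w) (Unique-resp-↭ (↭-sym (↭-reverse xs)) u) (i ∘ ∈-resp-↭ (↭-reverse xs))

  -- The indicator of x ~ a, in the form in which it contributes to length (nb x xs).
  ι : Fin n → Fin n → ℕ
  ι x a = length (nb x [ a ])

  length-nb-∷ : ∀ x a xs → length (nb x (a ∷ xs)) ≡ ι x a + length (nb x xs)
  length-nb-∷ x a xs with adj? x a
  ... | yes _ = refl
  ... | no  _ = refl

  ι-self : ∀ x → ι x x ≡ 0
  ι-self x = cong length (nb-self x [])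

  -- For `x` and `y` the ends of a path, this is the crossing pair of edges in Ore's argument for
  -- Hamiltonian cycles. They are separate from `a` and `b` because the induction moves the start of
  -- the walk while `x` and `y` stay fixed.
  record Crossing (x y a b : Fin n) (zs : List (Fin n)) : Set where
    constructor crossing
    field
      {us ws} : List (Fin n)
      {d c}   : Fin n
      zs≡     : zs ≡ us ++ ws
      before  : Walk a d us
      after   : Walk c b ws
      x~c     : Adj x c
      y~d     : Adj y d

  -- Without a crossing, each step d, c of the walk accounts for at most one of x ~ c and y ~ d.
  crossing⊎few : ∀ x y {a b zs} → Walk a b zs →
    Crossing x y a b zs ⊎ length (nb x zs) + length (nb y zs) < ι x a + ι y b + length zs
  crossing⊎few x y {a} stop = inj₂ (≤-reflexive (+-comm 1 (ι x a + ι y a)))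
  crossing⊎few x y {a} {b} (step {b = a′} {xs = zs} e w) with crossing⊎few x y w
  ... | inj₁ (crossing refl w₁ w₂ x~c y~d) = inj₁ (crossing refl (step e w₁) w₂ x~c y~d)
  ... | inj₂ few with both
    where
    both : (Adj x a′ × Adj y a) ⊎ ι x a′ + ι y a ≤ 1
    both with adj? x a′ | adj? y a
    ... | yes p | yes q = inj₁ (p , q)
    ... | yes _ | no  _ = inj₂ ≤-refl
    ... | no  _ | yes _ = inj₂ ≤-refl
    ... | no  _ | no  _ = inj₂ z≤n
  ...   | inj₁ (x~a′ , y~a) = inj₁ (crossing refl stop w x~a′ y~a)
  -- The induction hypothesis carries the term `ι x a′`; together with the new `ι y a` it is at most
  -- 1, which the added vertex `a` pays for.
  ...   | inj₂ ι≤1 = inj₂ (begin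
    suc (length (nb x (a ∷ zs)) + length (nb y (a ∷ zs)))
      ≡⟨ cong suc (cong₂ _+_ (length-nb-∷ x a zs) (length-nb-∷ y a zs)) ⟩
    suc ((ι x a + length (nb x zs)) + (ι y a + length (nb y zs)))
      ≡⟨ r₁ (ι x a) (length (nb x zs)) (ι y a) (length (nb y zs)) ⟩
    (ι x a + ι y a) + suc (length (nb x zs) + length (nb y zs))
      ≤⟨ +-monoʳ-≤ (ι x a + ι y a) few ⟩
    (ι x a + ι y a) + (ι x a′ + ι y b + length zs)
      ≡⟨ r₂ (ι x a) (ι y a) (ι x a′) (ι y b) (length zs) ⟩
    (ι x a′ + ι y a) + (ι x a + ι y b + length zs)
      ≤⟨ +-monoˡ-≤ (ι x a + ι y b + length zs) ι≤1 ⟩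
    suc (ι x a + ι y b + length zs)
      ≡⟨ +-suc (ι x a + ι y b) (length zs) ⟨
    ι x a + ι y b + suc (length zs) ∎)
    where
    open ≤-Reasoning
    r₁ : ∀ a b c d → suc ((a + b) + (c + d)) ≡ (a + c) + suc (b + d)
    r₁ = solve-∀
    r₂ : ∀ a b c d e → (a + b) + (c + d + e) ≡ (c + b) + (a + d + e)
    r₂ = solve-∀

  -- Such a walk closes up to a cycle, which may be opened at any vertex. This carries what holds at
  -- the start of a longest path to all vertices of a cycle.
  rotate : ∀ {a b x zs} → Walk a b zs → Adj b a → x ∈ zs →
           ∃₂ λ d zs′ → Walk x d zs′ × Adj d x × zs ↭ zs′
  rotate w b~a x∈ with ∈-∃++ x∈
  ... | ys , zs , refl with Walk-split ys w
  ...   | w₂ , inj₁ (refl , refl)    = _ , _ , w , b~a , ↭-refl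
  ...   | w₂ , inj₂ (d , w₁ , d~x)   = d , _ , Walk-join w₂ b~a w₁ , d~x , ++-comm ys (_ ∷ zs)

  -- The two outcomes for a longest path with k edges: c is the vertex set of a cycle through its
  -- k + 1 vertices, or v is one of its ends and has at most k / 2 neighbours.
  data Shape (A : List (Fin n)) (k : ℕ) : Set where
    cyclic  : ∀ {c} → Unique c → c ⊆ A → length c ≡ suc k →
              (∀ {x y} → x ∈ c → y ∈ A → Adj x y → y ∈ c) →
              (∀ {x y} → x ∈ c → y ∈ c → Adj x y → k ≤ p x y) →
              (∀ {x} → x ∈ c → ∃ λ y → y ∈ c × Adj x y) →
              Shape A k
    pendant : ∀ {v} → v ∈ A → 2 * length (nb v A) ≤ k →
              (∀ {y} → y ∈ A → Adj v y → k ≤ p v y) →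
              (1 ≤ k → 1 ≤ length (nb v A)) →
              Shape A k

  -- Only an upper bound, with `suc k` vertices for `k` edges; that it is attained is expressed by
  -- `length xs ≡ suc k` where required.
  Longest : List (Fin n) → ℕ → Set
  Longest A k = ∀ {a b xs} → PathIn A a b xs → length xs ≤ suc k

  module _ {A : List (Fin n)} {k : ℕ} (A! : Unique A) (longest-k : Longest A k) where

    -- A neighbour off the path could be put in front of it, giving a longer path in `A`.
    start-neighbour∈ : ∀ {a b xs y} → PathIn A a b xs → length xs ≡ suc k → y ∈ A → Adj a y → y ∈ xs
    start-neighbour∈ {xs = xs} {y} (path w u i) len y∈A a~y = decidable-stable (y ∈? xs) λ y∉xs →
      1+n≰n (≤-trans (≤-reflexive (cong suc (sym len))) (longest-k (extended y∉xs)))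
      where
      extended : y ∉ xs → PathIn A y _ (y ∷ xs)
      extended y∉xs = path (step (Adj-sym a~y) w)
        (All.tabulate (λ z∈ → λ { refl → y∉xs z∈ }) ∷ u) (λ { (here refl) → y∈A ; (there z∈) → i z∈ })

    degree≤ : ∀ {a b xs} → PathIn A a b xs → length xs ≡ suc k → length (nb a A) ≤ length (nb a xs)
    degree≤ {a} π len = Unique-⊆⇒length≤ (nb-Unique a A!) λ y∈ →
      ∈-filter⁺ (adj? a) (start-neighbour∈ π len (nb-⊆ a y∈) (∈-nb⁻ a {A} y∈)) (∈-nb⁻ a {A} y∈)

    -- All neighbours of the end in `A` lie on the path, so by `start-neighbour⇒≤p` each edge to
    -- them lies on a path with `k` edges.
    pendant-end : ∀ {a b xs} → PathIn A a b xs → length xs ≡ suc k → 2 * length (nb a A) ≤ k → Shape A k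
    pendant-end {a} {b} {xs} π@(path w u i) len few = pendant (i (Walk-start∈ w)) few
      (λ y∈ a~y → ≤-pred (≤-trans (≤-reflexive (sym len))
        (start-neighbour⇒≤p w u (start-neighbour∈ π len y∈ a~y) a~y)))
      (λ 1≤k → positive w i len 1≤k)
      where
      positive : ∀ {xs} → Walk a b xs → xs ⊆ A → length xs ≡ suc k → 1 ≤ k → 1 ≤ length (nb a A)
      positive stop        i refl ()
      positive (step e w)  i _    _ = ∈-length (∈-filter⁺ (adj? a) (i (there (Walk-start∈ w))) e)

    -- By `rotate` each vertex of the cycle starts a longest path with the same vertex set `c`.
    -- Hence its neighbours in `A` lie in `c`, and its edges lie on paths with `k` edges.
    cyclic-closed : ∀ {a b c} → PathIn A a b c → Adj b a → length c ≡ suc k → Shape A k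
    cyclic-closed {a} {b} {c} π@(path w u i) b~a len =
      cyclic u i len closed through neighbour
      where
      closed : ∀ {x y} → x ∈ c → y ∈ A → Adj x y → y ∈ c
      closed x∈ y∈ x~y with rotate w b~a x∈
      ... | d , c′ , w′ , _ , c↭c′ = ∈-resp-↭ (↭-sym c↭c′)
        (start-neighbour∈ (path w′ (Unique-resp-↭ c↭c′ u) (i ∘ ∈-resp-↭ (↭-sym c↭c′)))
                          (trans (↭-length (↭-sym c↭c′)) len) y∈ x~y)
      through : ∀ {x y} → x ∈ c → y ∈ c → Adj x y → k ≤ p x y
      through x∈ y∈ x~y with rotate w b~a x∈
      ... | d , c′ , w′ , _ , c↭c′ = ≤-pred (≤-trans (≤-reflexive (trans (sym len) (↭-length c↭c′)))
        (start-neighbour⇒≤p w′ (Unique-resp-↭ c↭c′ u) (∈-resp-↭ c↭c′ y∈) x~y))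
      neighbour : ∀ {x} → x ∈ c → ∃ λ y → y ∈ c × Adj x y
      neighbour x∈ with rotate w b~a x∈
      ... | d , c′ , w′ , d~x , c↭c′ = d , ∈-resp-↭ (↭-sym c↭c′) (Walk-end∈ w′) , Adj-sym d~x

    degrees≤k : ∀ {a b xs} → PathIn A a b xs → length xs ≡ suc k →
      length (nb a xs) + length (nb b xs) < ι a a + ι b b + length xs →
      length (nb a A) + length (nb b A) ≤ k
    degrees≤k {a} {b} {xs} π len few = ≤-pred (begin-strict
      length (nb a A) + length (nb b A)
        ≤⟨ +-mono-≤ (degree≤ π len) (degree≤ (PathIn-reverse π) (trans (↭-length (↭-reverse xs)) len)) ⟩
      length (nb a xs) + length (nb b (reverse xs))
        ≡⟨ cong (length (nb a xs) +_) (↭-length (filter-↭ (adj? b) (↭-reverse xs))) ⟩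
      length (nb a xs) + length (nb b xs)
        <⟨ few ⟩
      ι a a + ι b b + length xs
        ≡⟨ cong₂ _+_ (cong₂ _+_ (ι-self a) (ι-self b)) len ⟩
      suc k ∎)
      where open ≤-Reasoning

    shape : ∀ {a b xs} → PathIn A a b xs → length xs ≡ suc k → Shape A k
    shape {a} {b} {xs} π@(path w u i) len with crossing⊎few a b w
    -- The cycle follows `us` from `a`, jumps to `b`, runs back along `ws` and closes with the
    -- crossing edge at `a`. For `k = 1` it degenerates to a single edge.
    ... | inj₁ (crossing {us} {ws} refl w₁ w₂ a~c b~d) =
      cyclic-closed (path (Walk-join w₁ (Adj-sym b~d) (Walk-reverse w₂)) (Unique-resp-↭ (↭-sym perm) u) (i ∘ ∈-resp-↭ perm))
                    (Adj-sym a~c) (trans (↭-length perm) len)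
      where
      perm : us ++ reverse ws ↭ us ++ ws
      perm = ++⁺ˡ us (↭-reverse ws)
    -- The smaller of two degrees whose sum is at most `k` is at most half of `k`.
    ... | inj₂ few with ≤-total (length (nb a A)) (length (nb b A))
    ...   | inj₁ da≤db = pendant-end π len
      (≤-trans (+-monoʳ-≤ (length (nb a A)) (≤-trans (≤-reflexive (+-identityʳ _)) da≤db)) (degrees≤k π len few))
    ...   | inj₂ db≤da = pendant-end (PathIn-reverse π) (trans (↭-length (↭-reverse xs)) len)
      (≤-trans (+-mono-≤ db≤da (≤-reflexive (+-identityʳ _))) (degrees≤k π len few))

  -- Double negation avoids deciding the existence of paths; the goals it is used for are decidable.
  ¬¬-shape : ∀ {A} → Unique A → ∀ {x} → x ∈ A → ¬ ¬ (∃ λ k → Longest A k × Shape A k)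
  ¬¬-shape {A} A! {x} x∈A none = ¬¬-maximum {HasPath} n bounded {0} single maximal
    where
    HasPath : ℕ → Set
    HasPath k = ∃₂ λ a b → ∃ λ xs → PathIn A a b xs × length xs ≡ suc k
    bounded : ∀ m → HasPath m → m ≤ n
    bounded m (_ , _ , _ , π , len) = ≤-trans (n≤1+n m) (≤-trans (≤-reflexive (sym len)) (Unique⇒length≤n (unique π)))
    single : HasPath 0
    single = x , x , [ x ] , path stop ([] ∷ []) (λ { (here refl) → x∈A }) , refl
    maximal : ¬ (∃ λ k → HasPath k × ∀ m → HasPath m → m ≤ k)
    maximal (k , (_ , _ , _ , π , len) , max) = none (k , longest-k , shape A! longest-k π len)
      where
      longest-k : Longest A k
      longest-k {xs = []}     _  = z≤n
      longest-k {xs = y ∷ ys} π′ = s≤s (max (length ys) (_ , _ , _ , π′ , refl))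

  Closed : List (Fin n) → Set
  Closed A = ∀ {x y} → x ∈ A → Adj x y → y ∈ A

  -- The equality condition without components as sets: whatever can be reached from the start of a
  -- path with at least `t` vertices, hence length at least `t - 1`, is pairwise adjacent.
  LongPathsSpanCliques : ℕ → List (Fin n) → Set
  LongPathsSpanCliques t A = ∀ {a b xs u v} → PathIn A a b xs → t ≤ length xs →
                             Star Adj a u → Star Adj a v → u ≢ v → Adj u v

  Closed-Star : ∀ {A x y} → Closed A → x ∈ A → Star Adj x y → y ∈ A
  Closed-Star closed x∈ ε       = x∈
  Closed-Star closed x∈ (e ◅ s) = Closed-Star closed (closed x∈ e) s

  -- Used with `j = t ∸ 2`: the number of ways to extend an ordered edge to an ordered t-clique
  -- inside a clique on `p u v + 1` vertices. Here `p` always refers to the whole graph `G`, so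
  -- weights do not change when vertices are deleted.
  weight : ℕ → Fin n → Fin n → ℕ
  weight j u v = fall (p u v ∸ 1) j

  -- Deleting the vertices of a cycle or an end of small degree

  _∖_ : List (Fin n) → List (Fin n) → List (Fin n)
  A ∖ c = filter (λ x → ¬? (x ∈? c)) A

  ∖-Unique : ∀ {A} c → Unique A → Unique (A ∖ c)
  ∖-Unique c = Unique.filter⁺ (λ x → ¬? (x ∈? c))

  ∖-shorter : ∀ {A c x} → x ∈ A → x ∈ c → length (A ∖ c) < length A
  ∖-shorter {A} {c} x∈A x∈c = filter-notAll (λ x → ¬? (x ∈? c)) A (lose x∈A (λ x∉c → x∉c x∈c))

  -- No edge within `A` leaves `c`, so deleting `c` changes no neighbourhood of a remaining vertex.
  -- The summand `f` is general because `tuples` and `edgeSum` are both split in this way.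
  ∖-sum : ∀ {A c} → (∀ {x y} → x ∈ c → y ∈ A → Adj x y → y ∈ c) → (f : Fin n → List (Fin n) → ℕ) →
    sumBy A (λ u → f u (nb u A)) ≡ sumBy (filter (_∈? c) A) (λ u → f u (nb u A)) + sumBy (A ∖ c) (λ u → f u (nb u (A ∖ c)))
  ∖-sum {A} {c} closed f = trans (sumBy-partition (_∈? c) A _)
    (cong (sumBy (filter (_∈? c) A) (λ u → f u (nb u A)) +_) (sumBy-cong (A ∖ c) (λ {u} u∈ → cong (f u) (nb-∖ u∈))))
    where
    nb-∖ : ∀ {u} → u ∈ A ∖ c → nb u A ≡ nb u (A ∖ c)
    nb-∖ {u} u∈ with ∈-filter⁻ (λ x → ¬? (x ∈? c)) {xs = A} u∈
    ... | u∈A , u∉c = sym (trans (filter-comm (adj? u) (λ x → ¬? (x ∈? c)) A)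
      (filter-all (λ x → ¬? (x ∈? c)) (All.tabulate λ y∈ y∈c → u∉c (closed y∈c u∈A (Adj-sym (∈-nb⁻ u {A} y∈))))))

  common-nb-length : ∀ {A c x y} → Unique A → (∀ {z} → z ∈ A → Adj x z → z ∈ c) → x ∈ c → y ∈ nb x A →
                     2 + length (nb y (nb x A)) ≤ length c
  common-nb-length {A} {c} {x} {y} A! closed x∈ y∈ = Unique-⊆⇒length≤ uniq sub
    where
    uniq : Unique (x ∷ y ∷ nb y (nb x A))
    uniq = All.tabulate (λ { (here refl) → λ { refl → Adj-irrefl (∈-nb⁻ x {A} y∈) }
                           ; (there z∈)  → λ { refl → Adj-irrefl (∈-nb⁻ x {A} (nb-⊆ y z∈)) } })
           ∷ nb-Unique-∷ y (nb-Unique x A!)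
    sub : x ∷ y ∷ nb y (nb x A) ⊆ c
    sub (here refl)         = x∈
    sub (there (here refl)) = closed (nb-⊆ x y∈) (∈-nb⁻ x {A} y∈)
    sub (there (there z∈))  = closed (nb-⊆ x (nb-⊆ y z∈)) (∈-nb⁻ x {A} (nb-⊆ y z∈))

  -- Apart from `x` and `y` the set `c` has `k ∸ 1` vertices, so there are at most that many common
  -- neighbours, while `k ≤ p x y`.
  cyclic-tuples≤ : ∀ {A c k} j → Unique A → length c ≡ suc k →
    (∀ {x y} → x ∈ c → y ∈ A → Adj x y → y ∈ c) → (∀ {x y} → x ∈ c → y ∈ c → Adj x y → k ≤ p x y) →
    ∀ {x y} → x ∈ filter (_∈? c) A → y ∈ nb x A → tuples j (nb y (nb x A)) ≤ weight j x y
  cyclic-tuples≤ {A} {c} {k} j A! len closed through {x} {y} x∈ y∈ =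
    ≤-trans (tuples≤fall j (nb-Unique y (nb-Unique x A!)))
            (fall-mono j (∸-monoˡ-≤ 1 (≤-trans (≤-pred (≤-trans (common-nb-length A! (closed x∈c) x∈c y∈) (≤-reflexive len)))
                                               (through x∈c (closed x∈c (nb-⊆ x y∈) (∈-nb⁻ x {A} y∈)) (∈-nb⁻ x {A} y∈)))))
    where
    x∈c : x ∈ c
    x∈c = proj₂ (∈-filter⁻ (_∈? c) {xs = A} x∈)

  -- The effect of deleting one vertex on both sides, kept as separate estimates so that the
  -- inequality and its strict form can each combine them.
  record Removal (j k : ℕ) (A : List (Fin n)) : Set where
    field
      rest        : List (Fin n)
      rest!       : Unique rest
      rest-length : length A ≡ suc (length rest)
      degree      : ℕ
      degree-pos  : 1 ≤ k → 1 ≤ degree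
      2*degree≤k  : 2 * degree ≤ k
      tuples≤     : tuples (2 + j) A ≤ tuples (2 + j) rest + (2 + j) * fall degree (1 + j)
      edgeSum≥    : edgeSum (weight j) rest + 2 * (degree * fall (k ∸ 1) j) ≤ edgeSum (weight j) A

  -- With `v` moved to the front, `tuples-cons` and `edgeSum-cons` split off exactly its
  -- contribution. Its edges count in both directions, hence the factor 2.
  remove-pendant : ∀ {A k v} j → Unique A → v ∈ A → 2 * length (nb v A) ≤ k →
    (∀ {y} → y ∈ A → Adj v y → k ≤ p v y) → (1 ≤ k → 1 ≤ length (nb v A)) → Removal j k A
  remove-pendant {A} {k} {v} j A! v∈ few through positive with ∈-∃++ v∈
  ... | ys , zs , refl = record
    { rest        = A′
    ; rest!       = A′!
    ; rest-length = ↭-length perm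
    ; degree      = length (nb v A′)
    ; degree-pos  = λ 1≤k → ≤-trans (positive 1≤k) (≤-reflexive same-degree)
    ; 2*degree≤k  = ≤-trans (≤-reflexive (cong (2 *_) (sym same-degree))) few
    ; tuples≤     = begin
        tuples (2 + j) A
          ≡⟨ tuples-↭ (2 + j) perm ⟩
        tuples (2 + j) (v ∷ A′)
          ≡⟨ tuples-cons (suc j) v A′ ⟩
        tuples (2 + j) A′ + (2 + j) * tuples (1 + j) (nb v A′)
          ≤⟨ +-monoʳ-≤ (tuples (2 + j) A′) (*-monoʳ-≤ (2 + j) (tuples≤fall (1 + j) (nb-Unique v A′!))) ⟩
        tuples (2 + j) A′ + (2 + j) * fall (length (nb v A′)) (1 + j) ∎
    ; edgeSum≥    = begin
        edgeSum w A′ + 2 * (length (nb v A′) * f)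
          ≡⟨ cong (λ z → edgeSum w A′ + (length (nb v A′) * f + z)) (+-identityʳ _) ⟩
        edgeSum w A′ + (length (nb v A′) * f + length (nb v A′) * f)
          ≤⟨ +-monoʳ-≤ (edgeSum w A′) (+-mono-≤ (sumBy-≥const (nb v A′) f heavy) (sumBy-≥const (nb v A′) f heavy′)) ⟩
        edgeSum w A′ + (sumBy (nb v A′) (w v) + sumBy (nb v A′) (λ y → w y v))
          ≡⟨ edgeSum-cons w v A′ ⟨
        edgeSum w (v ∷ A′)
          ≡⟨ edgeSum-↭ w perm ⟨
        edgeSum w A ∎
    }
    where
    open ≤-Reasoning
    w  = weight j
    f  = fall (k ∸ 1) j
    A′ = ys ++ zs
    perm : ys ++ v ∷ zs ↭ v ∷ A′
    perm = shift v ys zs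
    A′! : Unique A′
    A′! with Unique-resp-↭ perm A!
    ... | _ ∷ u = u
    same-degree : length (nb v (ys ++ v ∷ zs)) ≡ length (nb v A′)
    same-degree = trans (↭-length (filter-↭ (adj? v) perm)) (cong length (nb-self v A′))
    heavy : ∀ {y} → y ∈ nb v A′ → f ≤ w v y
    heavy y∈ = fall-mono j (∸-monoˡ-≤ 1 (through (∈-resp-↭ (↭-sym perm) (there (nb-⊆ v y∈))) (∈-nb⁻ v {A′} y∈)))
    heavy′ : ∀ {y} → y ∈ nb v A′ → f ≤ w y v
    heavy′ {y} y∈ = subst (λ m → f ≤ fall (m ∸ 1) j) (p-sym v y) (heavy y∈)

  -- The induction runs on a bound `b` for the size, since the remaining vertices are in general not
  -- a tail of the list `A`.
  tuples≤edgeSum : ∀ j b A → length A ≤ b → Unique A → tuples (2 + j) A ≤ edgeSum (weight j) A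
  tuples≤edgeSum j b       []        _   _  = z≤n
  tuples≤edgeSum j (suc b) A@(x ∷ _) A≤b A! = decidable-stable (_ ≤? _) λ ¬goal →
    ¬¬-shape A! (here refl) λ { (k , _ , s) → ¬goal (by-shape s) }
    where
    by-shape : ∀ {k} → Shape A k → tuples (2 + j) A ≤ edgeSum (weight j) A
    -- By `len` the cycle has a vertex `y`, so what remains is strictly shorter than `A`.
    by-shape (cyclic {y ∷ c} _ c⊆A len closed through _) = begin
      tuples (2 + j) A
        ≡⟨ ∖-sum closed (λ _ → tuples (1 + j)) ⟩
      sumBy (filter (_∈? (y ∷ c)) A) (λ u → tuples (1 + j) (nb u A)) + tuples (2 + j) (A ∖ (y ∷ c))
        ≤⟨ +-mono-≤ (sumBy-mono (filter (_∈? (y ∷ c)) A) λ u∈ →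
                      sumBy-mono (nb _ A) (cyclic-tuples≤ j A! len closed through u∈))
                    (tuples≤edgeSum j b (A ∖ (y ∷ c))
                      (≤-pred (≤-trans (∖-shorter (c⊆A (here refl)) (here refl)) A≤b)) (∖-Unique (y ∷ c) A!)) ⟩
      sumBy (filter (_∈? (y ∷ c)) A) (λ u → sumBy (nb u A) (weight j u)) + edgeSum (weight j) (A ∖ (y ∷ c))
        ≡⟨ ∖-sum closed (λ u xs → sumBy xs (weight j u)) ⟨
      edgeSum (weight j) A ∎
      where open ≤-Reasoning
    by-shape {k} (pendant v∈ few through positive) = begin
      tuples (2 + j) A
        ≤⟨ tuples≤ ⟩
      tuples (2 + j) rest + (2 + j) * fall degree (1 + j)
        ≤⟨ +-mono-≤ (tuples≤edgeSum j b rest (≤-pred (≤-trans (≤-reflexive (sym rest-length)) A≤b)) rest!)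
                    ([2+j]fall≤2fall j {degree} 2*degree≤k) ⟩
      edgeSum (weight j) rest + 2 * (degree * fall (k ∸ 1) j)
        ≤⟨ edgeSum≥ ⟩
      edgeSum (weight j) A ∎
      where
      open ≤-Reasoning
      open Removal (remove-pendant j A! v∈ few through positive)

  -- If `y` is not adjacent to `x`, it is missing among the common neighbours of `x` and any
  -- neighbour `z` of `x`. Then at most `k - 2` of them exist, and since `2 + i ≤ k` the edge from
  -- `x` to `z` is strict.
  cyclic-complete : ∀ {A c k} i → Unique A → c ⊆ A → length c ≡ suc k → 2 + i ≤ k →
    (∀ {x y} → x ∈ c → y ∈ A → Adj x y → y ∈ c) → (∀ {x y} → x ∈ c → y ∈ c → Adj x y → k ≤ p x y) →
    (∀ {x} → x ∈ c → ∃ λ y → y ∈ c × Adj x y) →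
    (∀ {x y} → x ∈ filter (_∈? c) A → y ∈ nb x A → tuples (suc i) (nb y (nb x A)) ≡ weight (suc i) x y) →
    ∀ {x y} → x ∈ c → y ∈ c → x ≢ y → Adj x y
  cyclic-complete {A} {c} {suc k} i A! c⊆A len (s≤s i<k) closed through neighbour tight {x} {y} x∈ y∈ x≢y =
    decidable-stable (adj? x y) not-nonadjacent
    where
    open ≤-Reasoning
    not-nonadjacent : ¬ ¬ Adj x y
    not-nonadjacent ¬x~y with neighbour x∈
    ... | z , z∈ , x~z = <-irrefl (tight (∈-filter⁺ (_∈? c) (c⊆A x∈) x∈) z∈nb) (begin-strict
      tuples (suc i) common            ≤⟨ tuples≤fall (suc i) (nb-Unique z (nb-Unique x A!)) ⟩
      fall (length common) (suc i)     <⟨ fall-strict i small i<k ⟩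
      fall k (suc i)                   ≤⟨ fall-mono (suc i) (∸-monoˡ-≤ 1 (through x∈ z∈ x~z)) ⟩
      weight (suc i) x z               ∎)
      where
      z∈nb : z ∈ nb x A
      z∈nb = ∈-filter⁺ (adj? x) (c⊆A z∈) x~z
      common = nb z (nb x A)
      uniq : Unique (y ∷ x ∷ z ∷ common)
      uniq = All.tabulate (λ { (here refl)          → λ { refl → x≢y refl }
                             ; (there (here refl))  → λ { refl → ¬x~y x~z }
                             ; (there (there u∈))   → λ { refl → ¬x~y (∈-nb⁻ x {A} (nb-⊆ z u∈)) } })
           ∷ All.tabulate (λ { (here refl) → λ { refl → Adj-irrefl x~z }
                             ; (there u∈)  → λ { refl → Adj-irrefl (∈-nb⁻ x {A} (nb-⊆ z u∈)) } })
           ∷ nb-Unique-∷ z (nb-Unique x A!)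
      sub : y ∷ x ∷ z ∷ common ⊆ c
      sub (here refl)                 = y∈
      sub (there (here refl))         = x∈
      sub (there (there (here refl))) = z∈
      sub (there (there (there u∈)))  = closed x∈ (nb-⊆ x (nb-⊆ z u∈)) (∈-nb⁻ x {A} (nb-⊆ z u∈))
      small : length common < k
      small = ≤-pred (≤-pred (≤-trans (Unique-⊆⇒length≤ uniq sub) (≤-reflexive len)))

  -- A removable end of small degree would make the inequality strict. In the cyclic shape equality
  -- passes both to the edges of the cycle's vertex set and to the rest, where the induction
  -- continues.
  tight⇒cliques : ∀ i b A → length A ≤ b → Unique A → Closed A →
    tuples (3 + i) A ≡ edgeSum (weight (suc i)) A → LongPathsSpanCliques (3 + i) A
  tight⇒cliques i b []       _ _ _ _ (path w _ xs⊆A) _ _ _ _ with xs⊆A (Walk-start∈ w)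
  ... | ()
  tight⇒cliques i (suc b) A@(_ ∷ _) A≤b A! A-closed eq {a = a} {u = u} {v} π@(path w xs! xs⊆A) long a↝u a↝v u≢v =
    decidable-stable (adj? u v) λ ¬u~v →
      -- The given path has at least `3 + i` vertices, so `2 + i ≤ k`, as the strict estimates
      -- demand.
      ¬¬-shape A! (here refl) λ { (k , longest-k , s) → ¬u~v (by-shape (≤-pred (≤-trans long (longest-k π))) s) }
    where
    by-shape : ∀ {k} → 2 + i ≤ k → Shape A k → Adj u v
    by-shape {k} 2+i≤k (pendant v∈ few through positive) = ⊥-elim (<-irrefl eq (begin-strict
      tuples (3 + i) A
        ≤⟨ tuples≤ ⟩
      tuples (3 + i) rest + (3 + i) * fall degree (2 + i)
        <⟨ +-mono-≤-< (tuples≤edgeSum (suc i) (length rest) rest ≤-refl rest!)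
                      ([2+j]fall<2fall i {degree} (degree-pos (≤-trans (s≤s z≤n) 2+i≤k)) 2*degree≤k 2+i≤k) ⟩
      edgeSum (weight (suc i)) rest + 2 * (degree * fall (k ∸ 1) (suc i))
        ≤⟨ edgeSum≥ ⟩
      edgeSum (weight (suc i)) A ∎))
      where
      open ≤-Reasoning
      open Removal (remove-pendant (suc i) A! v∈ few through positive)
    by-shape {k} 2+i≤k (cyclic {c@(_ ∷ _)} _ c⊆A len closed through neighbour) = conclude (a ∈? c)
      where
      wt = weight (suc i)
      inC = filter (_∈? c) A
      pointwise : ∀ {x y} → x ∈ inC → y ∈ nb x A → tuples (suc i) (nb y (nb x A)) ≤ wt x y
      pointwise = cyclic-tuples≤ (suc i) A! len closed through
      rowwise : ∀ {x} → x ∈ inC → tuples (2 + i) (nb x A) ≤ sumBy (nb x A) (wt x)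
      rowwise x∈ = sumBy-mono (nb _ A) (pointwise x∈)
      parts : sumBy inC (λ x → tuples (2 + i) (nb x A)) ≡ sumBy inC (λ x → sumBy (nb x A) (wt x))
            × tuples (3 + i) (A ∖ c) ≡ edgeSum wt (A ∖ c)
      parts = +-tight (sumBy-mono inC rowwise)
                      (tuples≤edgeSum (suc i) (length (A ∖ c)) (A ∖ c) ≤-refl (∖-Unique c A!))
                      (trans (sym (∖-sum closed (λ _ → tuples (2 + i))))
                             (trans eq (∖-sum closed (λ x zs → sumBy zs (wt x)))))
      complete : ∀ {x y} → x ∈ c → y ∈ c → x ≢ y → Adj x y
      complete = cyclic-complete i A! c⊆A len 2+i≤k closed through neighbour λ {x} x∈ y∈ →
        sumBy-tight (nb x A) (pointwise x∈) (sumBy-tight inC rowwise (proj₁ parts) x∈) y∈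
      c-closed : Closed c
      c-closed x∈ x~y = closed x∈ (A-closed (c⊆A x∈) x~y) x~y
      avoids : ∀ {x y} → x ∉ c → Adj x y → y ∉ c
      avoids x∉c x~y y∈c = x∉c (c-closed y∈c (Adj-sym x~y))
      walk-avoids : ∀ {a b zs} → Walk a b zs → a ∉ c → ∀ {x} → x ∈ zs → x ∉ c
      walk-avoids stop       a∉c (here refl) = a∉c
      walk-avoids (step e w) a∉c (here refl) = a∉c
      walk-avoids (step e w) a∉c (there x∈)  = walk-avoids w (avoids a∉c e) x∈
      rest-closed : Closed (A ∖ c)
      rest-closed x∈ x~y with ∈-filter⁻ (λ x → ¬? (x ∈? c)) {xs = A} x∈
      ... | x∈A , x∉c = ∈-filter⁺ (λ x → ¬? (x ∈? c)) (A-closed x∈A x~y) (avoids x∉c x~y)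
      -- A path that starts in `c` reaches only vertices of the complete set `c`; one that starts
      -- outside never enters `c` and is a path of the rest.
      conclude : Dec (a ∈ c) → Adj u v
      conclude (yes a∈c) = complete (Closed-Star c-closed a∈c a↝u) (Closed-Star c-closed a∈c a↝v) u≢v
      conclude (no a∉c)  = tight⇒cliques i b (A ∖ c)
        (≤-pred (≤-trans (∖-shorter (c⊆A (here refl)) (here refl)) A≤b)) (∖-Unique c A!) rest-closed (proj₂ parts)
        (path w xs! (λ x∈ → ∈-filter⁺ (λ x → ¬? (x ∈? c)) (xs⊆A x∈) (walk-avoids w a∉c x∈)))
        long a↝u a↝v u≢v

-- Connected components and the edge list

-- Membership is settled one vertex at a time under a double negation. Applied to reachability, this
-- yields components as subsets.
¬¬-subset : ∀ {n} (P : Fin n → Set) → ¬ ¬ (∃ λ (S : Subset n) → ∀ v → v ∈ₛ S ⇔ P v)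
¬¬-subset {zero}  P none = none ([] , λ ())
¬¬-subset {suc n} P none = ¬¬-subset (P ∘ suc) λ (S , S⇔P) →
  outside-case S S⇔P λ p → inside-case S S⇔P p
  where
  inside-case : ∀ S → (∀ v → v ∈ₛ S ⇔ P (suc v)) → P zero → ⊥
  inside-case S S⇔P p = none (true ∷ S , λ
    { zero    → mk⇔ (λ _ → p) (λ _ → here)
    ; (suc v) → mk⇔ (Equivalence.to (S⇔P v) ∘ drop-there) (there ∘ Equivalence.from (S⇔P v)) })
  outside-case : ∀ S → (∀ v → v ∈ₛ S ⇔ P (suc v)) → ¬ ¬ P zero
  outside-case S S⇔P ¬p = none (false ∷ S , λ
    { zero    → mk⇔ (λ ()) (⊥-elim ∘ ¬p)
    ; (suc v) → mk⇔ (Equivalence.to (S⇔P v) ∘ drop-there) (there ∘ Equivalence.from (S⇔P v)) })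

vector : ∀ {A : Set} {m} (xs : List A) → length xs ≡ m → ∃ λ (q : Vec A m) → toList q ≡ xs
vector xs refl = fromList xs , Vec.toList∘fromList xs

sumBy-cartesianProduct : ∀ {A B : Set} (xs : List A) (ys : List B) (f : A × B → ℕ) →
  sumBy (cartesianProduct xs ys) f ≡ sumBy xs (λ x → sumBy ys (λ y → f (x , y)))
sumBy-cartesianProduct []       ys f = refl
sumBy-cartesianProduct (x ∷ xs) ys f = trans (sumBy-++ (map (x ,_) ys) _ f)
  (cong₂ _+_ (row ys) (sumBy-cartesianProduct xs ys f))
  where
  row : ∀ ys → sumBy (map (x ,_) ys) f ≡ sumBy ys (λ y → f (x , y))
  row []       = refl
  row (y ∷ ys) = cong (f (x , y) +_) (row ys)

module Components {n : ℕ} (G : Graph n) where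

  open Graph G renaming (sym to Adj-sym; irrefl to Adj-irrefl)
  open Tuples G
  open Extremal G

  Walk⇒Star : ∀ {a b xs x} → Walk a b xs → x ∈ xs → Star Adj a x
  Walk⇒Star stop       (here refl) = ε
  Walk⇒Star (step e w) (here refl) = ε
  Walk⇒Star (step e w) (there x∈)  = e ◅ Walk⇒Star w x∈

  -- `HasPathIn` asks for an exact length, while `LongPathsSpanCliques` speaks of all paths that are
  -- long enough.
  Walk-truncate : ∀ {a b xs} s → Walk a b xs → Unique xs → suc s ≤ length xs →
    ∃₂ λ c ys → Walk a c ys × Unique ys × ys ⊆ xs × length ys ≡ suc s
  Walk-truncate zero    stop       _ _ = _ , _ , stop , ([] ∷ []) , (λ x∈ → x∈) , refl
  Walk-truncate zero    (step e w) _ _ = _ , _ , stop , ([] ∷ []) , (λ { (here eq) → here eq }) , refl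
  Walk-truncate (suc s) stop       _ (s≤s ())
  Walk-truncate (suc s) (step e w) (x∉ ∷ u) (s≤s s<) with Walk-truncate s w u s<
  ... | c , ys , w′ , u′ , ys⊆ , len = c , _ , step e w′ , (All.tabulate (λ y∈ → All.lookup x∉ (ys⊆ y∈)) ∷ u′)
      , (λ { (here eq) → here eq ; (there y∈) → there (ys⊆ y∈) }) , cong suc len

  IsPath⇒PathIn : ∀ {m} {q : Vec (Fin n) (suc m)} → IsPath G q → ∃ λ b → PathIn V (Vec.head q) b (toList q)
  IsPath⇒PathIn {q = q} (u , l) with Linked⇒Walk q l
  ... | b , w = b , path w (toList-Unique⁺ u) (λ {x} _ → ∈-allFin x)

  Traverses⇒∈ : ∀ {m u v} {q : Vec (Fin n) (suc m)} → Traverses (u , v) q → u ∈ toList q × v ∈ toList q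
  Traverses⇒∈ {q = q} (i , inj₁ (refl , refl)) = ∈-toList⁺ (∈-lookup (inject₁ i) q) , ∈-toList⁺ (∈-lookup (suc i) q)
  Traverses⇒∈ {q = q} (i , inj₂ (refl , refl)) = ∈-toList⁺ (∈-lookup (suc i) q) , ∈-toList⁺ (∈-lookup (inject₁ i) q)

  -- If `p u v ≤ j` the weight vanishes. Otherwise a longest path through the edge lies in a clique,
  -- so its other `p u v ∸ 1` vertices are common neighbours of `u` and `v`, and all common
  -- neighbours are pairwise adjacent.
  cliques⇒weight≤ : ∀ j → LongPathsSpanCliques (2 + j) V → ∀ {u v} → Adj u v →
    weight j u v ≤ tuples j (nb v (nb u V))
  cliques⇒weight≤ j cl {u} {v} u~v with suc j ≤? p u v
  ... | no  j≮p = ≤-trans (≤-reflexive (fall-zero j (pred-< (≰⇒> j≮p) (1≤p u~v)))) z≤n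
    where
    pred-< : ∀ {m} → m < suc j → 1 ≤ m → m ∸ 1 < j
    pred-< {suc m} (s≤s m<j) _ = m<j
  ... | yes j<p with p-attained u v (1≤p u~v)
  ...   | q , q-path , tr with IsPath⇒PathIn {q = q} q-path | Traverses⇒∈ {q = q} tr
  ...     | b , π@(path w q! _) | u∈ , v∈ = begin
    fall (p u v ∸ 1) j          ≤⟨ fall-mono j (∸-monoˡ-≤ 1 (≤-pred size)) ⟩
    fall (length common) j      ≤⟨ fall≤tuples j (nb-Unique v (nb-Unique u (Unique.allFin⁺ n)))
                                                 (λ x∈ y∈ → clique (from-a x∈) (from-a y∈)) ⟩
    tuples j common             ∎
    where
    open ≤-Reasoning
    common = nb v (nb u V)
    len : length (toList q) ≡ suc (p u v)
    len = Vec.length-toList q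
    clique : ∀ {x y} → Star Adj (Vec.head q) x → Star Adj (Vec.head q) y → x ≢ y → Adj x y
    clique = cl π (≤-trans (s≤s j<p) (≤-reflexive (sym len)))
    from-a : ∀ {x} → x ∈ common → Star Adj (Vec.head q) x
    from-a x∈ = Walk⇒Star w u∈ ◅◅ (∈-nb⁻ u {V} (nb-⊆ v x∈) ◅ ε)
    cover : toList q ⊆ u ∷ v ∷ common
    cover {x} x∈ with x Fin.≟ u | x Fin.≟ v
    ... | yes refl | _        = here refl
    ... | no _     | yes refl = there (here refl)
    ... | no x≢u   | no x≢v   = there (there (∈-filter⁺ (adj? v)
          (∈-filter⁺ (adj? u) (∈-allFin x) (clique (Walk⇒Star w u∈) (Walk⇒Star w x∈) (x≢u ∘ sym)))
          (clique (Walk⇒Star w v∈) (Walk⇒Star w x∈) (x≢v ∘ sym))))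
    size : suc (p u v) ≤ 2 + length common
    size = ≤-trans (≤-reflexive (sym len)) (Unique-⊆⇒length≤ q! cover)

  cliques⇒edgeSum≤tuples : ∀ j → LongPathsSpanCliques (2 + j) V → edgeSum (weight j) V ≤ tuples (2 + j) V
  cliques⇒edgeSum≤tuples j cl = sumBy-mono V λ {u} _ → sumBy-mono (nb u V) λ v∈ → cliques⇒weight≤ j cl (∈-nb⁻ u {V} v∈)

  ComponentsCompleteOrShort : ℕ → Set
  ComponentsCompleteOrShort k = ∀ (S : Subset n) → IsComponent G S → CompleteOn G S ⊎ ¬ HasPathIn G S k

  -- The hypothesis is applied to the component of the start `a`; the given path, cut to length `s`,
  -- excludes the second alternative.
  components⇒cliques : ∀ s → ComponentsCompleteOrShort s → LongPathsSpanCliques (suc s) V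
  components⇒cliques s hyp {a} {b} {xs} {u} {v} (path w xs! _) long a↝u a↝v u≢v =
    decidable-stable (adj? u v) λ ¬u~v → ¬¬-subset (Star Adj a) λ (S , S⇔) → ¬u~v (by-component S S⇔)
    where
    by-component : ∀ S → (∀ x → x ∈ₛ S ⇔ Star Adj a x) → Adj u v
    by-component S S⇔ with hyp S component | Walk-truncate s w xs! long
      where
      component : IsComponent G S
      component = (a , Equivalence.from (S⇔ a) ε) , λ {x} x∈ y →
        mk⇔ (λ y∈ → Star.reverse Adj-sym (Equivalence.to (S⇔ x) x∈) ◅◅ Equivalence.to (S⇔ y) y∈)
            (λ x↝y → Equivalence.from (S⇔ y) (Equivalence.to (S⇔ x) x∈ ◅◅ x↝y))
    ... | inj₁ complete | _ = complete (Equivalence.from (S⇔ u) a↝u) (Equivalence.from (S⇔ v) a↝v) u≢v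
    ... | inj₂ no-path | c , ys , w′ , ys! , _ , len with vector ys len
    ...   | q , refl = ⊥-elim (no-path (q , (toList-Unique⁻ q ys! , Walk⇒Linked q w′)
                , λ i → Equivalence.from (S⇔ _) (Walk⇒Star w′ (∈-toList⁺ (∈-lookup i q)))))

  -- The alternative is chosen by a search for the path, which is decidable; if one is found, the
  -- whole component is reachable from its start.
  cliques⇒components : ∀ s → LongPathsSpanCliques (suc s) V → ComponentsCompleteOrShort s
  cliques⇒components s cl S (_ , S-component)
    with anyVec? (suc s) (λ q → isPath? G q ×-dec Fin.all? (λ i → lookup q i ∈ₛ? S))
  ... | no  none = inj₂ none
  ... | yes (q@(_ ∷ _) , q-path , q⊆S) with IsPath⇒PathIn {q = q} q-path
  ...   | b , π = inj₁ λ {u} {v} u∈ v∈ → cl π (≤-reflexive (sym (Vec.length-toList q)))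
                     (Equivalence.to (S-component (q⊆S zero) u) u∈) (Equivalence.to (S-component (q⊆S zero) v) v∈)

  -- `edges` keeps the pairs with `u < v`. Adding the transposed sum supplies the pairs in the other
  -- order, which carry the same value of `f`.
  2*edges : ∀ (f : Fin n × Fin n → ℕ) → (∀ u v → f (u , v) ≡ f (v , u)) →
            2 * sumBy (edges G) f ≡ edgeSum (λ u v → f (u , v)) V
  2*edges f f-sym = begin
    2 * sumBy (edges G) f
      ≡⟨ cong (2 *_) (trans (sumBy-filter (λ (u , v) → (u Fin.<? v) ×-dec adj? u v) (cartesianProduct V V) f)
                            (sumBy-cartesianProduct V V _)) ⟩
    2 * sumBy V (λ u → sumBy V (upper u))
      ≡⟨ cong (sumBy V (λ u → sumBy V (upper u)) +_) (trans (+-identityʳ _) (sumBy-swap V V upper)) ⟩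
    sumBy V (λ u → sumBy V (upper u)) + sumBy V (λ u → sumBy V (λ v → upper v u))
      ≡⟨ sumBy-+ V _ _ ⟨
    sumBy V (λ u → sumBy V (upper u) + sumBy V (λ v → upper v u))
      ≡⟨ sumBy-cong V (λ {u} _ → row u) ⟩
    edgeSum (λ u v → f (u , v)) V ∎
    where
    open ≡-Reasoning
    upper : Fin n → Fin n → ℕ
    upper u v = if does ((u Fin.<? v) ×-dec adj? u v) then f (u , v) else 0
    both : ∀ {u v} (d : Dec (Adj u v)) (d′ : Dec (Adj v u)) (l : Dec (u Fin.< v)) (l′ : Dec (v Fin.< u)) →
      (if does (l ×-dec d) then f (u , v) else 0) + (if does (l′ ×-dec d′) then f (v , u) else 0)
        ≡ (if does d then f (u , v) else 0)
    both (yes _)   (yes _)   (yes u<v) (yes v<u) = ⊥-elim (Fin.<-asym u<v v<u)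
    both (yes _)   (yes _)   (yes _)   (no _)    = +-identityʳ _
    both (yes _)   (yes _)   (no _)    (yes _)   = f-sym _ _
    both (yes u~v) (yes _)   (no u≮v)  (no v≮u)  = ⊥-elim (Adj⇒≢ u~v (Fin.≤-antisym (≮⇒≥ v≮u) (≮⇒≥ u≮v)))
    both (no _)    (no _)    (yes _)   (yes _)   = refl
    both (no _)    (no _)    (yes _)   (no _)    = refl
    both (no _)    (no _)    (no _)    (yes _)   = refl
    both (no _)    (no _)    (no _)    (no _)    = refl
    both (yes u~v) (no v≁u)  _         _         = ⊥-elim (v≁u (Adj-sym u~v))
    both (no u≁v)  (yes v~u) _         _         = ⊥-elim (u≁v (Adj-sym v~u))
    row : ∀ u → sumBy V (upper u) + sumBy V (λ v → upper v u) ≡ sumBy (nb u V) (λ v → f (u , v))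
    row u = begin
      sumBy V (upper u) + sumBy V (λ v → upper v u)
        ≡⟨ sumBy-+ V (upper u) (λ v → upper v u) ⟨
      sumBy V (λ v → upper u v + upper v u)
        ≡⟨ sumBy-cong V (λ {v} _ → both (adj? u v) (adj? v u) (u Fin.<? v) (v Fin.<? u)) ⟩
      sumBy V (λ v → if does (adj? u v) then f (u , v) else 0)
        ≡⟨ sumBy-filter (adj? u) V (λ v → f (u , v)) ⟨
      sumBy (nb u V) (λ v → f (u , v)) ∎

-- Copies of the complete graph as cliques

-- Injectivity is required on the entries alone, because `vertexList` forgets the edges and is
-- injective on copies of `K t` but not on all subgraphs.
Unique-map-local : ∀ {A B : Set} {f : A → B} {xs} →
  (∀ {x y} → x ∈ xs → y ∈ xs → f x ≡ f y → x ≡ y) → Unique xs → Unique (map f xs)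
Unique-map-local inj []       = []
Unique-map-local {f = f} {x ∷ xs} inj (x∉ ∷ u) =
  All.tabulate fresh ∷ Unique-map-local (λ y∈ z∈ → inj (there y∈) (there z∈)) u
  where
  fresh : ∀ {z} → z ∈ map f xs → f x ≢ z
  fresh z∈ fx≡z with ∈-map⁻ f z∈
  ... | y , y∈ , refl = All.lookup x∉ y∈ (inj (here refl) (there y∈) fx≡z)

Unique⇒AllPairs : ∀ {A : Set} {R : A → A → Set} {xs} →
  (∀ {x y} → x ∈ xs → y ∈ xs → x ≢ y → R x y) → Unique xs → AllPairs R xs
Unique⇒AllPairs r []       = []
Unique⇒AllPairs r (x∉ ∷ u) = All.tabulate (λ y∈ → r (here refl) (there y∈) (All.lookup x∉ y∈))
                             ∷ Unique⇒AllPairs (λ y∈ z∈ → r (there y∈) (there z∈)) u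

Unique-⊆-⊇⇒length≡ : ∀ {A : Set} {xs ys : List A} → Unique xs → Unique ys → xs ⊆ ys → ys ⊆ xs → length xs ≡ length ys
Unique-⊆-⊇⇒length≡ u u′ s s′ = ≤-antisym (Unique-⊆⇒length≤ u s) (Unique-⊆⇒length≤ u′ s′)

-- Completeness of the enumeration of subgraphs

allVecs-complete : ∀ {A : Set} {xs : List A} → (∀ x → x ∈ xs) → ∀ {k} (v : Vec A k) → v ∈ allVecs xs k
allVecs-complete all []      = here refl
allVecs-complete all (x ∷ v) = ∈-cartesianProductWith⁺ _∷_ (all x) (allVecs-complete all v)

allVecs-Unique : ∀ {A : Set} {xs : List A} → Unique xs → ∀ k → Unique (allVecs xs k)
allVecs-Unique u zero    = [] ∷ []
allVecs-Unique u (suc k) = Unique.cartesianProductWith⁺ _∷_ Vec.∷-injective u (allVecs-Unique u k)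

allSubgraphData-complete : ∀ {n} (H : SubgraphData n) → H ∈ allSubgraphData n
allSubgraphData-complete (vs ▸ rs) =
  ∈-cartesianProductWith⁺ _▸_ (allVecs-complete bools vs) (allVecs-complete (allVecs-complete bools) rs)
  where
  bools : ∀ b → b ∈ true ∷ false ∷ []
  bools true  = here refl
  bools false = there (here refl)

allSubgraphData-Unique : ∀ n → Unique (allSubgraphData n)
allSubgraphData-Unique n = Unique.cartesianProductWith⁺ _▸_ (λ { refl → refl , refl })
  (allVecs-Unique bools n) (allVecs-Unique (allVecs-Unique bools n) n)
  where
  bools : Unique (true ∷ false ∷ [])
  bools = ((λ ()) ∷ []) ∷ [] ∷ []

subset : ∀ {n} {P : Fin n → Set} → Decidable P → Subset n
subset P? = tabulate (λ v → does (P? v))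

∈-subset⁺ : ∀ {n} {P : Fin n → Set} (P? : Decidable P) {v} → P v → v ∈ₛ subset P?
∈-subset⁺ P? {v} pv = Vec.lookup⇒[]= v (subset P?) (trans (Vec.lookup∘tabulate _ v) (dec-true (P? v) pv))

∈-subset⁻ : ∀ {n} {P : Fin n → Set} (P? : Decidable P) {v} → v ∈ₛ subset P? → P v
∈-subset⁻ P? {v} v∈ with P? v | trans (sym (Vec.lookup∘tabulate (λ v → does (P? v)) v)) (Vec.[]=⇒lookup v∈)
... | yes pv | _  = pv
... | no  _  | ()

module CliqueCount {n : ℕ} (G : Graph n) where

  open Graph G renaming (sym to Adj-sym; irrefl to Adj-irrefl)
  open Tuples G
  open DecMembership (Fin._≟_ {n}) using (_∈?_)
  open SubgraphData

  ∈-cliques⁻ : ∀ t xs {ys} → ys ∈ cliques t xs → ys ⊑ xs × AllPairs Adj ys × length ys ≡ t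
  ∈-cliques⁻ zero    xs       (here refl) = minimum xs , [] , refl
  ∈-cliques⁻ (suc t) (x ∷ xs) ys∈ with ∈-++⁻ (map (x ∷_) (cliques t (nb x xs))) ys∈
  ... | inj₂ ys∈′ with ∈-cliques⁻ (suc t) xs ys∈′
  ...   | s , r , len = x ∷ʳ s , r , len
  ∈-cliques⁻ (suc t) (x ∷ xs) ys∈ | inj₁ ys∈′ with ∈-map⁻ (x ∷_) ys∈′
  ...   | zs , zs∈ , refl with ∈-cliques⁻ t (nb x xs) zs∈
  ...     | s , r , len = refl ∷ ⊆-trans s (filter-⊆ (adj? x) xs)
                        , All.tabulate (λ z∈ → ∈-nb⁻ x {xs} (⊑-lookup s z∈)) ∷ r , cong suc len

  ∈-cliques⁺ : ∀ {xs} ys → ys ⊑ xs → AllPairs Adj ys → ys ∈ cliques (length ys) xs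
  ∈-cliques⁺ []       _ _ = here refl
  ∈-cliques⁺ (y ∷ ys) (x ∷ʳ s) r = ∈-++⁺ʳ (map (x ∷_) _) (∈-cliques⁺ (y ∷ ys) s r)
  ∈-cliques⁺ (x ∷ ys) (refl ∷ s) (x~ ∷ r) = ∈-++⁺ˡ (∈-map⁺ (x ∷_) (∈-cliques⁺ ys
    (subst (_⊑ _) (filter-all (adj? x) x~) (filter⁺ (adj? x) (adj? x) (λ { refl e → e }) s)) r))

  cliques-Unique : ∀ t {xs} → Unique xs → Unique (cliques t xs)
  cliques-Unique zero    u = [] ∷ []
  cliques-Unique (suc t) {[]}     u = []
  cliques-Unique (suc t) {x ∷ xs} u@(_ ∷ u′) = Unique.++⁺
    (Unique.map⁺ ∷-injectiveʳ (cliques-Unique t (nb-Unique x u′))) (cliques-Unique (suc t) u′)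
    λ (ys∈ , ys∈′) → disjoint ys∈ ys∈′
    where
    disjoint : ∀ {ys} → ys ∈ map (x ∷_) (cliques t (nb x xs)) → ys ∉ cliques (suc t) xs
    disjoint ys∈ ys∈′ with ∈-map⁻ (x ∷_) ys∈
    ... | _ , _ , refl = Unique.Unique[x∷xs]⇒x∉xs u (⊑-lookup (proj₁ (∈-cliques⁻ (suc t) xs ys∈′)) (here refl))

  filter-∈-sublist : ∀ {xs ys} → ys ⊑ xs → Unique xs → filter (_∈? ys) xs ≡ ys
  filter-∈-sublist []        _ = refl
  filter-∈-sublist {ys = ys} (x ∷ʳ s) u@(_ ∷ u′) =
    trans (filter-reject (_∈? ys) (λ x∈ → Unique.Unique[x∷xs]⇒x∉xs u (⊑-lookup s x∈))) (filter-∈-sublist s u′)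
  filter-∈-sublist {x ∷ xs} {_ ∷ ys} (refl ∷ s) u@(_ ∷ u′) = trans (filter-accept (_∈? (x ∷ ys)) (here refl))
    (cong (x ∷_) (trans (filter-cong (_∈? (x ∷ ys)) (_∈? ys) xs tail∈ (λ _ → there)) (filter-∈-sublist s u′)))
    where
    tail∈ : ∀ {z} → z ∈ xs → z ∈ x ∷ ys → z ∈ ys
    tail∈ z∈xs (here refl)  = ⊥-elim (Unique.Unique[x∷xs]⇒x∉xs u z∈xs)
    tail∈ _    (there z∈ys) = z∈ys

  IsClique : ℕ → SubgraphData n → Set
  IsClique t H = IsSubgraph G H × Isomorphic (K t) H

  -- The vertices in the order of `V`, which is the form in which `cliques` lists them.
  vertexList : SubgraphData n → List (Fin n)
  vertexList H = filter (_∈ₛ? verts H) V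

  ∈-vertexList⁺ : ∀ H {v} → v ∈ₛ verts H → v ∈ vertexList H
  ∈-vertexList⁺ H v∈ = ∈-filter⁺ (_∈ₛ? verts H) (∈-allFin _) v∈

  ∈-vertexList⁻ : ∀ H {v} → v ∈ vertexList H → v ∈ₛ verts H
  ∈-vertexList⁻ H v∈ = proj₂ (∈-filter⁻ (_∈ₛ? verts H) {xs = V} v∈)

  -- The isomorphism joins any two distinct vertices, so a copy of `K t` is determined by its vertex
  -- set.
  clique-edges : ∀ {t H} → IsClique t H → ∀ u v → Edge H u v ⇔ (u ∈ₛ verts H × v ∈ₛ verts H × u ≢ v)
  clique-edges {t} {H} (sub , f , f-inj , f-onto , f-edge) u v = mk⇔ to from
    where
    to : Edge H u v → u ∈ₛ verts H × v ∈ₛ verts H × u ≢ v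
    to e with sub u v e
    ... | _ , u∈ , v∈ , u~v = u∈ , v∈ , Adj⇒≢ u~v
    from : u ∈ₛ verts H × v ∈ₛ verts H × u ≢ v → Edge H u v
    from (u∈ , v∈ , u≢v) with Equivalence.to (f-onto u) u∈ | Equivalence.to (f-onto v) v∈
    ... | i , refl | j , refl = Equivalence.to (f-edge i j) (λ { refl → u≢v refl })

  vertexList-injective : ∀ {t H H′} → IsClique t H → IsClique t H′ → vertexList H ≡ vertexList H′ → H ≡ H′
  vertexList-injective {t} {H} {H′} c c′ eq = cong₂ _▸_ (⊆-antisym vs⊆ vs⊇) rows≡
    where
    vs⊆ : ∀ {v} → v ∈ₛ verts H → v ∈ₛ verts H′
    vs⊆ {v} v∈ = ∈-vertexList⁻ H′ (subst (v ∈_) eq (∈-vertexList⁺ H v∈))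
    vs⊇ : ∀ {v} → v ∈ₛ verts H′ → v ∈ₛ verts H
    vs⊇ {v} v∈ = ∈-vertexList⁻ H (subst (v ∈_) (sym eq) (∈-vertexList⁺ H′ v∈))
    row≡ : ∀ u → Vec.lookup (rows H) u ≡ Vec.lookup (rows H′) u
    row≡ u = ⊆-antisym
      (λ {v} e → let u∈ , v∈ , u≢v = Equivalence.to (clique-edges {H = H} c u v) e in
        Equivalence.from (clique-edges {H = H′} c′ u v) (vs⊆ u∈ , vs⊆ v∈ , u≢v))
      (λ {v} e → let u∈ , v∈ , u≢v = Equivalence.to (clique-edges {H = H′} c′ u v) e in
        Equivalence.from (clique-edges {H = H} c u v) (vs⊇ u∈ , vs⊇ v∈ , u≢v))
    rows≡ : rows H ≡ rows H′
    rows≡ = trans (sym (Vec.tabulate∘lookup (rows H))) (trans (Vec.tabulate-cong row≡) (Vec.tabulate∘lookup (rows H′)))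

  vertexList∈cliques : ∀ {t H} → IsClique t H → vertexList H ∈ cliques t V
  vertexList∈cliques {t} {H} c@(sub , f , f-inj , f-onto , f-edge) =
    subst (λ s → vertexList H ∈ cliques s V) len
      (∈-cliques⁺ (vertexList H) (filter-⊆ (_∈ₛ? verts H) V) (Unique⇒AllPairs adjacent list!))
    where
    list! : Unique (vertexList H)
    list! = Unique.filter⁺ (_∈ₛ? verts H) (Unique.allFin⁺ n)
    adjacent : ∀ {u v} → u ∈ vertexList H → v ∈ vertexList H → u ≢ v → Adj u v
    adjacent {u} {v} u∈ v∈ u≢v = proj₂ (proj₂ (proj₂ (sub u v
      (Equivalence.from (clique-edges {H = H} c u v) (∈-vertexList⁻ H u∈ , ∈-vertexList⁻ H v∈ , u≢v)))))
    len : length (vertexList H) ≡ t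
    len = trans (Unique-⊆-⊇⇒length≡ list! (toList-Unique⁺ f!) into onto) (Vec.length-toList f)
      where
      f! : VecUnique f
      f! = subst VecUnique (Vec.tabulate∘lookup f) (VecUnique.tabulate⁺ (f-inj _ _))
      into : vertexList H ⊆ toList f
      into v∈ with Equivalence.to (f-onto _) (∈-vertexList⁻ H v∈)
      ... | i , refl = ∈-toList⁺ (∈-lookup i f)
      onto : toList f ⊆ vertexList H
      onto {v} v∈ = ∈-vertexList⁺ H (Equivalence.from (f-onto v)
        (VecAny.index (∈-toList⁻ v∈) , sym (VecAny.lookup-index (∈-toList⁻ v∈))))

  inside? : ∀ (ys : List (Fin n)) u → Decidable (λ v → u ∈ ys × v ∈ ys × u ≢ v)
  inside? ys u v = (u ∈? ys) ×-dec (v ∈? ys) ×-dec ¬? (u Fin.≟ v)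

  completeOn : List (Fin n) → SubgraphData n
  completeOn ys = subset (_∈? ys) ▸ tabulate (λ u → subset (inside? ys u))

  vertexList-completeOn : ∀ {ys} → ys ⊑ V → vertexList (completeOn ys) ≡ ys
  vertexList-completeOn {ys} s = trans
    (filter-cong (_∈ₛ? subset (_∈? ys)) (_∈? ys) V (λ _ → ∈-subset⁻ (_∈? ys)) (λ _ → ∈-subset⁺ (_∈? ys)))
    (filter-∈-sublist s (Unique.allFin⁺ n))

  completeOn-IsClique : ∀ {t ys} → ys ⊑ V → AllPairs Adj ys → length ys ≡ t → IsClique t (completeOn ys)
  completeOn-IsClique {t} {ys} s r len = sub , iso (vector ys len)
    where
    edge⁻ : ∀ u v → Edge (completeOn ys) u v → u ∈ ys × v ∈ ys × u ≢ v
    edge⁻ u v e = ∈-subset⁻ (inside? ys u) (subst (v ∈ₛ_) (Vec.lookup∘tabulate _ u) e)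
    edge⁺ : ∀ u v → u ∈ ys × v ∈ ys × u ≢ v → Edge (completeOn ys) u v
    edge⁺ u v e = subst (v ∈ₛ_) (sym (Vec.lookup∘tabulate _ u)) (∈-subset⁺ (inside? ys u) e)
    adjacent : ∀ {u v} → u ∈ ys → v ∈ ys → u ≢ v → Adj u v
    adjacent u∈ v∈ u≢v with ∈-AllPairs₂ r u∈ v∈
    ... | inj₁ u≡v        = ⊥-elim (u≢v u≡v)
    ... | inj₂ (inj₁ u~v) = u~v
    ... | inj₂ (inj₂ v~u) = Adj-sym v~u
    sub : IsSubgraph G (completeOn ys)
    sub u v e with edge⁻ u v e
    ... | u∈ , v∈ , u≢v =
      edge⁺ v u (v∈ , u∈ , u≢v ∘ sym) , ∈-subset⁺ (_∈? ys) u∈ , ∈-subset⁺ (_∈? ys) v∈ , adjacent u∈ v∈ u≢v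
    ys! : Unique ys
    ys! = subst Unique (vertexList-completeOn s) (Unique.filter⁺ (_∈ₛ? subset (_∈? ys)) (Unique.allFin⁺ n))
    iso : (∃ λ (f : Vec (Fin n) t) → toList f ≡ ys) → Isomorphic (K t) (completeOn ys)
    iso (f , refl) = f , f-inj
      , (λ v → mk⇔ (λ v∈ → let v∈f = ∈-toList⁻ (∈-subset⁻ (_∈? ys) v∈) in VecAny.index v∈f , sym (VecAny.lookup-index v∈f))
                   (λ { (i , refl) → ∈-subset⁺ (_∈? ys) (f∈ i) }))
      , (λ i j → mk⇔ (λ i≢j → edge⁺ _ _ (f∈ i , f∈ j , i≢j ∘ f-inj i j))
                     (λ e i≡j → proj₂ (proj₂ (edge⁻ _ _ e)) (cong (Vec.lookup f) i≡j)))
      where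
      f-inj : ∀ i j → Vec.lookup f i ≡ Vec.lookup f j → i ≡ j
      f-inj = VecUnique.lookup-injective (toList-Unique⁻ f ys!)
      f∈ : ∀ i → Vec.lookup f i ∈ toList f
      f∈ i = ∈-toList⁺ (∈-lookup i f)

  -- `vertexList` maps the copies of `K t` bijectively onto the cliques, with inverse `completeOn`.
  N≡length-cliques : ∀ t → N G (K t) ≡ length (cliques t V)
  N≡length-cliques t = trans (sym (length-map vertexList found))
    (Unique-⊆-⊇⇒length≡ (Unique-map-local (λ x∈ y∈ → vertexList-injective (isClique x∈) (isClique y∈)) found!)
                      (cliques-Unique t (Unique.allFin⁺ n)) into onto)
    where
    clique? : Decidable (IsClique t)
    clique? H = isSubgraph? G H ×-dec isomorphic? (K t) H
    found = filter clique? (allSubgraphData n)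
    found! : Unique found
    found! = Unique.filter⁺ clique? (allSubgraphData-Unique n)
    isClique : ∀ {H} → H ∈ found → IsClique t H
    isClique H∈ = proj₂ (∈-filter⁻ clique? {xs = allSubgraphData n} H∈)
    into : map vertexList found ⊆ cliques t V
    into ys∈ with ∈-map⁻ vertexList ys∈
    ... | H , H∈ , refl = vertexList∈cliques {H = H} (isClique H∈)
    onto : cliques t V ⊆ map vertexList found
    onto {ys} ys∈ with ∈-cliques⁻ t V ys∈
    ... | s , r , len = subst (_∈ map vertexList found) (vertexList-completeOn s)
      (∈-map⁺ vertexList (∈-filter⁺ clique? (allSubgraphData-complete (completeOn ys)) (completeOn-IsClique s r len)))

-- Rational arithmetic and the comparison of the two sides

-- `÷` reduces to lowest terms; passing to unnormalised fractions turns comparisons into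
-- cross-multiplication.
÷-≃ : ∀ a b → toℚᵘ (a ÷ suc b) ℚᵘ.≃ mkℚᵘ (ℤ.+ a) b
÷-≃ a b = ℚ.toℚᵘ-fromℚᵘ (mkℚᵘ (ℤ.+ a) b)

÷-cong : ∀ {a b c d} → a * suc d ≡ c * suc b → a ÷ suc b ≡ c ÷ suc d
÷-cong {a} {b} {c} {d} eq = ℚ.fromℚᵘ-cong {mkℚᵘ (ℤ.+ a) b} {mkℚᵘ (ℤ.+ c) d}
  (*≡* (trans (sym (ℤ.pos-* a (suc d))) (trans (cong ℤ.+_ eq) (ℤ.pos-* c (suc b)))))

÷-injective : ∀ {a b c d} → a ÷ suc b ≡ c ÷ suc d → a * suc d ≡ c * suc b
÷-injective {a} {b} {c} {d} eq with ℚᵘ.≃-trans (ℚᵘ.≃-sym (÷-≃ a b)) (ℚᵘ.≃-trans (ℚᵘ.≃-reflexive (cong toℚᵘ eq)) (÷-≃ c d))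
... | *≡* e = ℤ.+-injective (trans (ℤ.pos-* a (suc d)) (trans e (sym (ℤ.pos-* c (suc b)))))

÷-mono : ∀ {a b c d} → a * suc d ≤ c * suc b → a ÷ suc b ℚ.≤ c ÷ suc d
÷-mono {a} {b} {c} {d} le = ℚ.toℚᵘ-cancel-≤ (ℚᵘ.≤-respˡ-≃ (ℚᵘ.≃-sym (÷-≃ a b)) (ℚᵘ.≤-respʳ-≃ (ℚᵘ.≃-sym (÷-≃ c d))
  (*≤* (subst₂ ℤ._≤_ (ℤ.pos-* a (suc d)) (ℤ.pos-* c (suc b)) (ℤ.+≤+ le)))))

1÷-* : ∀ c d → (1 ÷ suc d) ℚ.* (c ÷ 1) ≡ c ÷ suc d
1÷-* c d = ℚ.toℚᵘ-injective (begin
  toℚᵘ ((1 ÷ suc d) ℚ.* (c ÷ 1))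
    ≈⟨ ℚ.toℚᵘ-homo-* (1 ÷ suc d) (c ÷ 1) ⟩
  toℚᵘ (1 ÷ suc d) ℚᵘ.* toℚᵘ (c ÷ 1)
    ≈⟨ ℚᵘ.*-cong (÷-≃ 1 d) (÷-≃ c 0) ⟩
  mkℚᵘ (ℤ.+ 1) d ℚᵘ.* mkℚᵘ (ℤ.+ c) 0
    ≈⟨ *≡* (cong₂ ℤ._*_ (ℤ.*-identityˡ (ℤ.+ c)) (cong (ℤ.+_ ∘ suc) (sym (*-identityʳ d)))) ⟩
  mkℚᵘ (ℤ.+ c) d
    ≈⟨ ÷-≃ c d ⟨
  toℚᵘ (c ÷ suc d) ∎)
  where open ℚᵘ.≃-Reasoning

÷1-+ : ∀ a b → (a ÷ 1) ℚ.+ (b ÷ 1) ≡ (a + b) ÷ 1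
÷1-+ a b = ℚ.toℚᵘ-injective (begin
  toℚᵘ ((a ÷ 1) ℚ.+ (b ÷ 1))
    ≈⟨ ℚ.toℚᵘ-homo-+ (a ÷ 1) (b ÷ 1) ⟩
  toℚᵘ (a ÷ 1) ℚᵘ.+ toℚᵘ (b ÷ 1)
    ≈⟨ ℚᵘ.+-cong (÷-≃ a 0) (÷-≃ b 0) ⟩
  mkℚᵘ (ℤ.+ a) 0 ℚᵘ.+ mkℚᵘ (ℤ.+ b) 0
    ≈⟨ *≡* (cong (ℤ._* ℤ.+ 1) (cong₂ ℤ._+_ (ℤ.*-identityʳ (ℤ.+ a)) (ℤ.*-identityʳ (ℤ.+ b)))) ⟩
  mkℚᵘ (ℤ.+ (a + b)) 0
    ≈⟨ ÷-≃ (a + b) 0 ⟨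
  toℚᵘ ((a + b) ÷ 1) ∎)
  where open ℚᵘ.≃-Reasoning

sumOver-÷1 : ∀ {A : Set} (xs : List A) (f : A → ℕ) → sumOver xs (λ x → f x ÷ 1) ≡ sumBy xs f ÷ 1
sumOver-÷1 []       f = refl
sumOver-÷1 (x ∷ xs) f = trans (cong ((f x ÷ 1) ℚ.+_) (sumOver-÷1 xs f)) (÷1-+ (f x) (sumBy xs f))

sumOver-* : ∀ {A : Set} (xs : List A) r {f g : A → ℚ} → (∀ {x} → x ∈ xs → f x ≡ r ℚ.* g x) →
            sumOver xs f ≡ r ℚ.* sumOver xs g
sumOver-* []       r f≡ = sym (ℚ.*-zeroʳ r)
sumOver-* (x ∷ xs) r {f} {g} f≡ = trans (cong₂ ℚ._+_ (f≡ (here refl)) (sumOver-* xs r (f≡ ∘ there)))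
                                (sym (ℚ.*-distribˡ-+ r (g x) (sumOver xs g)))

1≤C2 : ∀ m → 1 ≤ (2 + m) C 2
1≤C2 m = *-cancelˡ-< 2 0 ((2 + m) C 2) (≤-trans (s≤s z≤n) (≤-reflexive (sym (2*C2 m))))

cross-multiply : ∀ a b c d → 1 ≤ b → 1 ≤ d → a * d ≡ c * b → a ÷ b ≡ (1 ÷ d) ℚ.* (c ÷ 1)
cross-multiply a (suc b) c (suc d) _ _ eq = trans (÷-cong {a} {b} {c} {d} eq) (sym (1÷-* c d))

÷1≤ : ∀ a c d → 1 ≤ d → a * d ≤ c → a ÷ 1 ℚ.≤ (1 ÷ d) ℚ.* (c ÷ 1)
÷1≤ a c (suc d) _ le = subst (a ÷ 1 ℚ.≤_) (sym (1÷-* c d))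
  (÷-mono {a} {0} {c} {d} (≤-trans le (≤-reflexive (sym (*-identityʳ c)))))

÷1-injective : ∀ a c d → 1 ≤ d → a ÷ 1 ≡ (1 ÷ d) ℚ.* (c ÷ 1) → a * d ≡ c
÷1-injective a c (suc d) _ eq = trans (÷-injective {a} {0} {c} {d} (trans eq (1÷-* c d))) (*-identityʳ c)

-- After cross-multiplication this is `C-subset-of-subset`; by `1 ≤ q` the arguments `q + 1` and
-- `q ∸ 1` differ by exactly 2.
C-quotient : ∀ t → 2 ≤ t → ∀ q → 1 ≤ q →
  ((q + 1) C t) ÷ ((q + 1) C 2) ≡ (1 ÷ (t C 2)) ℚ.* (((q ∸ 1) C (t ∸ 2)) ÷ 1)
C-quotient (suc (suc j)) (s≤s (s≤s z≤n)) (suc q) _ rewrite +-comm q 1 =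
  cross-multiply ((2 + q) C (2 + j)) ((2 + q) C 2) (q C j) ((2 + j) C 2) (1≤C2 q) (1≤C2 j) (C-subset-of-subset q j)

-- From ordered counts to the stated inequality

module Comparison {n : ℕ} (G : Graph n) where

  open Tuples G
  open Extremal G
  open Components G
  open CliqueCount G using (N≡length-cliques)

  edgeTotal : ℕ → ℕ
  edgeTotal t = sumBy (edges G) (λ e → (longest G e ∸ 1) C (t ∸ 2))

  -- On the left, this times `t C 2` is `t !`, the number of orderings of a clique. On the right, 2
  -- accounts for the two directions of an edge and the factorial turns binomials into falling
  -- factorials.
  scale : ℕ → ℕ
  scale t = 2 * (t ∸ 2) !

  scale*N : ∀ t → 2 ≤ t → scale t * (N G (K t) * (t C 2)) ≡ tuples t V
  scale*N t@(suc (suc j)) (s≤s (s≤s z≤n)) = begin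
    2 * j ! * (N G (K t) * (t C 2))                  ≡⟨ r₁ (j !) (N G (K t)) (t C 2) ⟩
    2 * (t C 2) * (j ! * N G (K t))                  ≡⟨ cong₂ (λ x y → x * (j ! * y)) (2*C2 j) (N≡length-cliques t) ⟩
    t * (1 + j) * (j ! * length (cliques t V))       ≡⟨ r₂ t (1 + j) (j !) (length (cliques t V)) ⟩
    t ! * length (cliques t V)                       ≡⟨ tuples≡!*cliques t V ⟨
    tuples t V                                       ∎
    where
    open ≡-Reasoning
    r₁ : ∀ x y z → 2 * x * (y * z) ≡ 2 * z * (x * y)
    r₁ = solve-∀
    r₂ : ∀ x y z w → x * y * (z * w) ≡ x * (y * z) * w
    r₂ = solve-∀

  scale*edgeTotal : ∀ t → scale t * edgeTotal t ≡ edgeSum (weight (t ∸ 2)) V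
  scale*edgeTotal t = begin
    2 * j ! * edgeTotal t
      ≡⟨ *-assoc 2 (j !) (edgeTotal t) ⟩
    2 * (j ! * edgeTotal t)
      ≡⟨ cong (2 *_) (sumBy-*ˡ (edges G) (j !) _) ⟨
    2 * sumBy (edges G) (λ e → j ! * ((longest G e ∸ 1) C j))
      ≡⟨ cong (2 *_) (sumBy-cong (edges G) (λ {e} _ → fall≡!*C (longest G e ∸ 1) j)) ⟨
    2 * sumBy (edges G) (λ e → fall (longest G e ∸ 1) j)
      ≡⟨ 2*edges (λ e → fall (longest G e ∸ 1) j) (λ u v → cong (λ m → fall (m ∸ 1) j) (p-sym u v)) ⟩
    edgeSum (weight j) V ∎
    where
    open ≡-Reasoning
    j = t ∸ 2

  scale-nonZero : ∀ t → NonZero (scale t)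
  scale-nonZero t = m*n≢0 2 ((t ∸ 2) !) ⦃ _ ⦄ ⦃ (t ∸ 2) !≢0 ⦄

  tuples≤edgeSum-V : ∀ t → 2 ≤ t → tuples t V ≤ edgeSum (weight (t ∸ 2)) V
  tuples≤edgeSum-V (suc (suc j)) (s≤s (s≤s z≤n)) = tuples≤edgeSum j (length V) V ≤-refl (Unique.allFin⁺ n)

  tuples≡edgeSum⇒components : ∀ t → 3 ≤ t → tuples t V ≡ edgeSum (weight (t ∸ 2)) V → ComponentsCompleteOrShort (t ∸ 1)
  tuples≡edgeSum⇒components (suc (suc (suc i))) (s≤s (s≤s (s≤s z≤n))) eq = cliques⇒components (2 + i)
    (tight⇒cliques i (length V) V ≤-refl (Unique.allFin⁺ n) (λ {_} {y} _ _ → ∈-allFin y) eq)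

  components⇒tuples≡edgeSum : ∀ t → 3 ≤ t → ComponentsCompleteOrShort (t ∸ 1) → tuples t V ≡ edgeSum (weight (t ∸ 2)) V
  components⇒tuples≡edgeSum t@(suc (suc (suc i))) (s≤s (s≤s (s≤s z≤n))) complete = ≤-antisym
    (tuples≤edgeSum-V t (s≤s (s≤s z≤n))) (cliques⇒edgeSum≤tuples (suc i) (components⇒cliques (2 + i) complete))

  -- For `t = 2` every weight is 1, and both sides unfold to the number of ordered adjacent pairs.
  tuples≡edgeSum-2 : ∀ t → t ≡ 2 → tuples t V ≡ edgeSum (weight (t ∸ 2)) V
  tuples≡edgeSum-2 _ refl = refl

  N*C2≤edgeTotal : ∀ t → 2 ≤ t → N G (K t) * (t C 2) ≤ edgeTotal t
  N*C2≤edgeTotal t 2≤t = *-cancelˡ-≤ (scale t) ⦃ scale-nonZero t ⦄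
    (subst₂ _≤_ (sym (scale*N t 2≤t)) (sym (scale*edgeTotal t)) (tuples≤edgeSum-V t 2≤t))

  N*C2≡edgeTotal : ∀ t → 2 ≤ t → tuples t V ≡ edgeSum (weight (t ∸ 2)) V → N G (K t) * (t C 2) ≡ edgeTotal t
  N*C2≡edgeTotal t 2≤t eq = *-cancelˡ-≡ (N G (K t) * (t C 2)) (edgeTotal t) (scale t) ⦃ scale-nonZero t ⦄
    (trans (scale*N t 2≤t) (trans eq (sym (scale*edgeTotal t))))

  tuples≡edgeSum : ∀ t → 2 ≤ t → N G (K t) * (t C 2) ≡ edgeTotal t → tuples t V ≡ edgeSum (weight (t ∸ 2)) V
  tuples≡edgeSum t 2≤t eq = trans (sym (scale*N t 2≤t)) (trans (cong (scale t *_) eq) (scale*edgeTotal t))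

  bound : ℕ → ℚ
  bound t = sumOver (edges G) (λ e → ((longest G e + 1) C t) ÷ ((longest G e + 1) C 2))

  bound≡ : ∀ t → 2 ≤ t → bound t ≡ (1 ÷ (t C 2)) ℚ.* sumOver (edges G) (λ e → ((longest G e ∸ 1) C (t ∸ 2)) ÷ 1)
  bound≡ t 2≤t = sumOver-* (edges G) (1 ÷ (t C 2)) λ {e} e∈ → C-quotient t 2≤t (longest G e) (1≤p (adjacent e∈))
    where
    adjacent : ∀ {e} → e ∈ edges G → Graph.Adj G (proj₁ e) (proj₂ e)
    adjacent e∈ = proj₂ (proj₂ (∈-filter⁻ (λ (u , v) → (u Fin.<? v) ×-dec Graph.adj? G u v) {xs = cartesianProduct V V} e∈))

  bound≡edgeTotal : ∀ t → 2 ≤ t → bound t ≡ (1 ÷ (t C 2)) ℚ.* (edgeTotal t ÷ 1)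
  bound≡edgeTotal t 2≤t = trans (bound≡ t 2≤t)
    (cong ((1 ÷ (t C 2)) ℚ.*_) (sumOver-÷1 (edges G) (λ e → (longest G e ∸ 1) C (t ∸ 2))))

  1≤tC2 : ∀ t → 2 ≤ t → 1 ≤ t C 2
  1≤tC2 (suc (suc j)) (s≤s (s≤s z≤n)) = 1≤C2 j

  count≤bound : ∀ t → 2 ≤ t → N G (K t) ÷ 1 ℚ.≤ bound t
  count≤bound t 2≤t = subst (N G (K t) ÷ 1 ℚ.≤_) (sym (bound≡edgeTotal t 2≤t))
    (÷1≤ (N G (K t)) (edgeTotal t) (t C 2) (1≤tC2 t 2≤t) (N*C2≤edgeTotal t 2≤t))

  count≡bound⁺ : ∀ t → 2 ≤ t → tuples t V ≡ edgeSum (weight (t ∸ 2)) V → N G (K t) ÷ 1 ≡ bound t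
  count≡bound⁺ t 2≤t eq = trans
    (cross-multiply (N G (K t)) 1 (edgeTotal t) (t C 2) ≤-refl (1≤tC2 t 2≤t)
      (trans (N*C2≡edgeTotal t 2≤t eq) (sym (*-identityʳ (edgeTotal t)))))
    (sym (bound≡edgeTotal t 2≤t))

  count≡bound⁻ : ∀ t → 2 ≤ t → N G (K t) ÷ 1 ≡ bound t → tuples t V ≡ edgeSum (weight (t ∸ 2)) V
  count≡bound⁻ t 2≤t eq = tuples≡edgeSum t 2≤t
    (÷1-injective (N G (K t)) (edgeTotal t) (t C 2) (1≤tC2 t 2≤t) (trans eq (bound≡edgeTotal t 2≤t)))

theorem3 : ∀ (t : ℕ) → 2 ≤ t → ∀ (n : ℕ) (G : Graph n) →
    let p = longest G
        count = N G (K t) ÷ 1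
        bound = sumOver (edges G) (λ e → ((p e + 1) C t) ÷ ((p e + 1) C 2))
    in (count ℚ.≤ bound)
     × (bound ≡ (1 ÷ (t C 2)) ℚ.* sumOver (edges G) (λ e → ((p e ∸ 1) C (t ∸ 2)) ÷ 1))
     × (t ≡ 2 → count ≡ bound)
     × (3 ≤ t → (count ≡ bound) ⇔
         (∀ (S : Subset n) → IsComponent G S → CompleteOn G S ⊎ ¬ HasPathIn G S (t ∸ 1)))
theorem3 t 2≤t n G =
    count≤bound t 2≤t
  , bound≡ t 2≤t
  , (λ t≡2 → count≡bound⁺ t 2≤t (tuples≡edgeSum-2 t t≡2))
  , (λ 3≤t → mk⇔ (λ eq → tuples≡edgeSum⇒components t 3≤t (count≡bound⁻ t 2≤t eq))
                 (λ hyp → count≡bound⁺ t 2≤t (components⇒tuples≡edgeSum t 3≤t hyp)))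
  where open Comparison G
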